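{- Let $(\mathcal G,c)$ be either $(\mathcal G_d,c_d)$ or $(\mathcal G_u,c_u)$, and let $g:\mathcal D\setminus\mathcal B\to\mathbb{R}^{\ge 2}$ and $h:\mathcal D\setminus\mathcal B\to\mathbb{R}^{>0}$ be functions. Suppose that for all $(n,s,t)\in\mathcal D\setminus\mathcal B$ the following conditions hold: (1) for any $(G,S,T)\in\mathcal G$ with $(|G|,|S|,|T|)=(n,s,t)$, there exists an element $k\in G\setminus\{0_G\}$ accounting for at least $h(n,s,t)$ elements of $T$ with respect to $S$; (2) for every $(n',s',t')\in\mathcal D\setminus\mathcal B$ with $n'\le \frac n2$, $s'\le s$, $t'\le t$, either $g(n,s,t)\ge c(n',s',t')$ or $g(n,s,t)\ge g(n',s',t')$; (3) for every integer $t'$ with $1\le t'\le t-h(n,s,t)$, $g(n,s,t)\ge g(n,s,t')+1$. Then $c(n,s,t)\le g(n,s,t)$ for every $(n,s,t)\in\mathcal D\setminus\mathcal B$.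
   Context: $\mathcal G_d$ is the class of triples $(G,S,T)$ where $G$ is a finite abelian group (written additively), $S$ is a generating set of $G$ with $0_G\notin S$, and $T\subseteq S$. $\mathcal G_u$ is the subclass of those with $S=-S$. $\mathcal D=\{(n,s,t)\in\mathbb N^3: n\ge1,\ n-1\ge s\ge t\ge 0\}$ (with $0\in\mathbb N$), and $\mathcal B=\{(n,s,t)\in\mathcal D: t=0\text{ or }s=n-1\}$. An element $k\in G\setminus\{0_G\}$ accounts for $a\in S$ with respect to $S$ if there is $b\in S\cup\{0_G\}$ with $a-b=k$. $\mathrm{Cay}(G,S)$ is the digraph with vertex set $G$ and an arc from $u$ to $v$ iff $v-u\in S$. The game of cops and robbers on $\mathrm{Cay}(G,S)$ with robber moveset $T$: each cop chooses a starting vertex, then the robber does; then cop turns and robber turns alternate, starting with a cop turn. On a cop turn each cop at $x$ moves to $x+s$ for some $s\in S$, or stays. On a robber turn the robber at $r$ moves to $r+a$ for some $a\in T$, or stays. Full information; several cops may share a vertex. The cops win iff at some point a cop shares a vertex with the robber. For $(n,s,t)\in\mathcal D$, $c_d(n,s,t)$ (resp. $c_u(n,s,t)$) is the maximum, over all triples $(G,S,T)\in\mathcal G_d$ (resp. $\mathcal G_u$) with $(|G|,|S|,|T|)=(n,s,t)$, of the minimum number of cops having a winning strategy in the game on $\mathrm{Cay}(G,S)$ with robber moveset $T$; if there is no such triple, the value is defined to be $1$. -}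

module Defs where

open import Algebra.Bundles using (AbelianGroup)
open import Algebra.Structures using (IsAbelianGroup)
open import Data.Fin.Base using (Fin; combine; remQuot; finToFun; funToFin)
open import Data.Fin.Properties using (_≟_; all?; any?; remQuot-combine; finToFun-funToFin)
open import Data.Fin.Subset using (Subset; ∣_∣; _∪_; ⊥) renaming (_∈_ to _∈ˢ_; _⊆_ to _⊆ˢ_)
open import Data.Fin.Subset.Properties using (_⊆?_; anySubset?; p⊂q⇒∣p∣<∣q∣; ∣p∣≤n; p⊆p∪q; q⊆p∪q; x∈p∪q⁻; ∉⊥) renaming (_∈?_ to _∈ˢ?_)
open import Data.Integer.Base using (+_)
open import Data.Nat.Base as ℕ using (ℕ; zero; suc)
open import Data.Nat.Induction using (<-wellFounded)
import Data.Nat.Properties as ℕ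
open import Data.Product.Base using (Σ; _×_; _,_; ∃-syntax; proj₁; proj₂)
open import Data.Product.Properties using (≡-dec)
open import Data.Rational.Unnormalised.Base as ℚᵘ using (ℚᵘ; mkℚᵘ; 0ℚᵘ; *≡*)
import Data.Rational.Unnormalised.Properties as ℚᵘ
open import Data.Rational.Unnormalised.Solver using (module +-*-Solver)
open import Data.Refinement.Base using (Refinement; refine; value)
open import Data.Sum.Base using (_⊎_; inj₁; inj₂; [_,_]′)
open import Data.Unit.Base using (⊤; tt)
open import Data.Vec.Base using (tabulate)
open import Data.Vec.Properties using (lookup∘tabulate; []=⇒lookup; lookup⇒[]=)
open import Function.Base using (_∘_; id)
open import Function.Bundles using (Inverse)
open import Function.Construct.Identity using () renaming (inverse to idInverse)
open import Induction.WellFounded using (Acc; acc)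
open import Level using (0ℓ)
open import Relation.Binary.PropositionalEquality as ≡ using (_≡_; refl; cong; cong₂; subst)
open import Relation.Nullary.Decidable using (Dec; yes; no; does; True; toWitness; fromWitness; map′; _×-dec_; _⊎-dec_; _→-dec_; ¬?; decidable-stable; dec-true)
open import Relation.Nullary.Negation.Core using (¬_; contradiction)
open import Relation.Unary using (Pred; Decidable; _≐_)

-- Real numbers as Bishop's regular sequences of rationals.

module Real where

  -- mkℚᵘ (+ a) n is the fraction a / (n + 1).

  1/1+_ 2/1+_ : ℕ → ℚᵘ
  1/1+ n = mkℚᵘ (+ 1) n
  2/1+ n = mkℚᵘ (+ 2) n

  record ℝ : Set where
    field
      seq     : ℕ → ℚᵘ
      regular : ∀ m n → ℚᵘ.∣ seq m ℚᵘ.- seq n ∣ ℚᵘ.≤ 1/1+ m ℚᵘ.+ 1/1+ n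

  open ℝ public

  fromℕ : ℕ → ℝ
  fromℕ k .seq     _   = mkℚᵘ (+ k) 0
  fromℕ k .regular m n = begin
    ℚᵘ.∣ q ℚᵘ.- q ∣      ≃⟨ ℚᵘ.∣-∣-cong (ℚᵘ.+-inverseʳ q) ⟩
    0ℚᵘ                  ≤⟨ ℚᵘ.nonNegative⁻¹ (1/1+ m ℚᵘ.+ 1/1+ n) ⟩
    1/1+ m ℚᵘ.+ 1/1+ n   ∎
    where
    open ℚᵘ.≤-Reasoning
    q = mkℚᵘ (+ k) 0

  -- The index n ↦ 2n + 1 halves the bound: 2 · 1 / (2n + 2) = 1 / (n + 1).

  private
    twice : ℕ → ℕ
    twice n = suc (2 ℕ.* n)

    halves : ∀ n → 1/1+ (twice n) ℚᵘ.+ 1/1+ (twice n) ℚᵘ.≃ 1/1+ n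
    halves n = *≡* (cong +_ (lemma n))
      where
      open import Data.Nat.Solver using () renaming (module +-*-Solver to ℕ-Solver)
      open ℕ-Solver
      lemma : ∀ n → (1 ℕ.* suc (twice n) ℕ.+ 1 ℕ.* suc (twice n)) ℕ.* suc n
                  ≡ 1 ℕ.* (suc (twice n) ℕ.* suc (twice n))
      lemma = solve 1 (λ n →
        let d = con 2 :+ con 2 :* n in
        (con 1 :* d :+ con 1 :* d) :* (con 1 :+ n) := con 1 :* (d :* d)) refl

  infixl 6 _+_ _-_
  infix  8 -_
  infix  4 _≤_ _<_ _≥_

  _+_ : ℝ → ℝ → ℝ
  (x + y) .seq     n   = seq x (twice n) ℚᵘ.+ seq y (twice n)
  (x + y) .regular m n = begin
    ℚᵘ.∣ (a ℚᵘ.+ b) ℚᵘ.- (c ℚᵘ.+ d) ∣           ≃⟨ ℚᵘ.∣-∣-cong (swap a b c d) ⟩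
    ℚᵘ.∣ (a ℚᵘ.- c) ℚᵘ.+ (b ℚᵘ.- d) ∣           ≤⟨ ℚᵘ.∣p+q∣≤∣p∣+∣q∣ (a ℚᵘ.- c) (b ℚᵘ.- d) ⟩
    ℚᵘ.∣ a ℚᵘ.- c ∣ ℚᵘ.+ ℚᵘ.∣ b ℚᵘ.- d ∣        ≤⟨ ℚᵘ.+-mono-≤ (regular x (twice m) (twice n))
                                                                (regular y (twice m) (twice n)) ⟩
    (u ℚᵘ.+ v) ℚᵘ.+ (u ℚᵘ.+ v)                  ≃⟨ shuffle u v ⟩
    (u ℚᵘ.+ u) ℚᵘ.+ (v ℚᵘ.+ v)                  ≃⟨ ℚᵘ.+-cong (halves m) (halves n) ⟩
    1/1+ m ℚᵘ.+ 1/1+ n                          ∎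
    where
    open ℚᵘ.≤-Reasoning
    a = seq x (twice m)
    b = seq y (twice m)
    c = seq x (twice n)
    d = seq y (twice n)
    u = 1/1+ (twice m)
    v = 1/1+ (twice n)
    open +-*-Solver
    swap : ∀ a b c d → (a ℚᵘ.+ b) ℚᵘ.- (c ℚᵘ.+ d) ℚᵘ.≃ (a ℚᵘ.- c) ℚᵘ.+ (b ℚᵘ.- d)
    swap = solve 4 (λ a b c d → (a :+ b) :- (c :+ d) := (a :- c) :+ (b :- d)) ℚᵘ.≃-refl
    shuffle : ∀ u v → (u ℚᵘ.+ v) ℚᵘ.+ (u ℚᵘ.+ v) ℚᵘ.≃ (u ℚᵘ.+ u) ℚᵘ.+ (v ℚᵘ.+ v)
    shuffle = solve 2 (λ u v → (u :+ v) :+ (u :+ v) := (u :+ u) :+ (v :+ v)) ℚᵘ.≃-refl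

  -_ : ℝ → ℝ
  (- x) .seq     n   = ℚᵘ.- seq x n
  (- x) .regular m n = begin
    ℚᵘ.∣ ℚᵘ.- a ℚᵘ.- ℚᵘ.- b ∣   ≡⟨ cong ℚᵘ.∣_∣ (ℚᵘ.neg-distrib-+ a (ℚᵘ.- b)) ⟨
    ℚᵘ.∣ ℚᵘ.- (a ℚᵘ.- b) ∣      ≡⟨ ℚᵘ.∣-p∣≡∣p∣ (a ℚᵘ.- b) ⟩
    ℚᵘ.∣ a ℚᵘ.- b ∣             ≤⟨ regular x m n ⟩
    1/1+ m ℚᵘ.+ 1/1+ n          ∎
    where
    open ℚᵘ.≤-Reasoning
    a = seq x m
    b = seq x n

  _-_ : ℝ → ℝ → ℝ
  x - y = x + - y

  -- The n-th term is within 1 / (n + 1) of the real it approximates, so a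
  -- gap of more than 2 / (n + 1) between two n-th terms separates the reals;
  -- x ≤ y says that no such gap shows y < x.

  _<_ _≤_ _≥_ : ℝ → ℝ → Set
  x < y = ∃[ n ] seq x n ℚᵘ.+ 2/1+ n ℚᵘ.< seq y n
  x ≤ y = ∀ n → seq x n ℚᵘ.≤ seq y n ℚᵘ.+ 2/1+ n
  x ≥ y = y ≤ x

open Real public using (ℝ; fromℕ)
  renaming (_+_ to _+ᴿ_; _-_ to _-ᴿ_; _<_ to _<ᴿ_; _≤_ to _≤ᴿ_; _≥_ to _≥ᴿ_)

record FiniteAbelianGroup : Set₁ where
  field
    abelianGroup : AbelianGroup 0ℓ 0ℓ
    order        : ℕ
    enumeration  : Inverse (AbelianGroup.setoid abelianGroup) (≡.setoid (Fin order))

  open AbelianGroup abelianGroup public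
    renaming (_∙_ to _+_; ε to 0#; _⁻¹ to -_)

  -- A subset of the group is a set of indices of the enumeration.

  infix 4 _∈_
  _∈_ : Carrier → Subset order → Set
  x ∈ A = Inverse.to enumeration x ∈ˢ A

  data Span (A : Subset order) : Pred Carrier 0ℓ where
    gen  : ∀ {x} → x ∈ A → Span A x
    zero : Span A 0#
    add  : ∀ {x y} → Span A x → Span A y → Span A (x + y)
    neg  : ∀ {x} → Span A x → Span A (- x)
    resp : ∀ {x y} → x ≈ y → Span A x → Span A y

  Generates : Subset order → Set
  Generates A = ∀ x → Span A x

  -- A = - A
  Symmetric : Subset order → Set
  Symmetric A = (_∈ A) ≐ (λ x → ∃[ a ] a ∈ A × x ≈ - a)

record Triple : Set₁ where
  field
    G         : FiniteAbelianGroup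
  open FiniteAbelianGroup G public
  field
    S T       : Subset order
    generates : Generates S
    0∉S       : ¬ (0# ∈ S)
    T⊆S       : T ⊆ˢ S

  card : ℕ × ℕ × ℕ
  card = order , ∣ S ∣ , ∣ T ∣

  AccountsFor : Carrier → Carrier → Set
  AccountsFor k a = ∃[ b ] (b ∈ S ⊎ b ≈ 0#) × a - b ≈ k

  AccountsForAtLeast : ℝ → Carrier → Set
  AccountsForAtLeast h k =
    ∃[ A ] A ⊆ˢ T × (∀ a → a ∈ A → AccountsFor k a) × fromℕ ∣ A ∣ ≥ᴿ h

data Kind : Set where
  directed undirected : Kind

-- 𝒢 directed is 𝒢_d, 𝒢 undirected is 𝒢_u.

𝒢 : Kind → Pred Triple 0ℓ
𝒢 directed   X = ⊤
𝒢 undirected X = let open Triple X in Symmetric S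

-- Cops and robbers on Cay(G , S) with robber moveset T.

module Game (X : Triple) where
  open Triple X

  Step : Subset order → Carrier → Carrier → Set
  Step A x y = y ≈ x ⊎ ∃[ a ] a ∈ A × y ≈ x + a

  module _ {m : ℕ} where

    Cops : Set
    Cops = Fin m → Carrier

    Caught : Cops → Carrier → Set
    Caught x r = ∃[ i ] x i ≈ r

    -- Winning strategies for the cops from a given position, as well-founded
    -- trees: one move of the cops at each of their turns, a branch for every
    -- move of the robber at his, and a capture at the end of every branch.

    data CopTurn (x : Cops) (r : Carrier) : Set
    data RobberTurn (x : Cops) (r : Carrier) : Set

    data CopTurn x r where
      caught : Caught x r → CopTurn x r
      move   : (y : Cops) → (∀ i → Step S (x i) (y i)) → RobberTurn y r → CopTurn x r

    data RobberTurn x r where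
      caught : Caught x r → RobberTurn x r
      move   : (∀ r′ → Step T r r′ → CopTurn x r′) → RobberTurn x r

  CopsWin : ℕ → Set
  CopsWin m = ∃[ x ] ∀ r → CopTurn {m} x r

  IsCopNumber : ℕ → Set
  IsCopNumber m = CopsWin m × ∀ k → CopsWin k → m ℕ.≤ k

open Game public using (CopsWin; IsCopNumber)

InD InB : ℕ × ℕ × ℕ → Set
InD (n , s , t) = n ℕ.≥ 1 × n ℕ.∸ 1 ℕ.≥ s × s ℕ.≥ t
InB (n , s , t) = t ≡ 0 ⊎ s ≡ n ℕ.∸ 1

InD∖B : ℕ × ℕ × ℕ → Set
InD∖B p = InD p × ¬ InB p

-- Membership proofs are irrelevant, so a function on 𝒟 or 𝒟∖ℬ depends on the
-- numbers n, s, t only.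

𝒟 𝒟∖ℬ : Set
𝒟   = Refinement (ℕ × ℕ × ℕ) InD
𝒟∖ℬ = Refinement (ℕ × ℕ × ℕ) InD∖B

inclusion : 𝒟∖ℬ → 𝒟
inclusion = refine proj₁

-- m is the largest cop number of the members of 𝒢 κ with cardinalities p, or
-- 1 if there is no such member.

IsMaxCopNumber : Kind → ℕ × ℕ × ℕ → ℕ → Set₁
IsMaxCopNumber κ p m =
    ((∃[ X ] 𝒢 κ X × Triple.card X ≡ p × IsCopNumber X m)
     × (∀ X → 𝒢 κ X → Triple.card X ≡ p → ∀ k → IsCopNumber X k → k ℕ.≤ m))
  ⊎ ((¬ (∃[ X ] 𝒢 κ X × Triple.card X ≡ p)) × m ≡ 1)

-- The maximum exists: winning is decidable, and every triple is isomorphic to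
-- one of the finitely many with carrier Fin n.

module Existence where

  module Finite where

    ⟦_⟧ : ∀ {N} {P : Pred (Fin N) 0ℓ} → Decidable P → Subset N
    ⟦ P? ⟧ = tabulate (does ∘ P?)

    module _ {N} {P : Pred (Fin N) 0ℓ} (P? : Decidable P) where

      ∈⁺ : ∀ {i} → P i → i ∈ˢ ⟦ P? ⟧
      ∈⁺ {i} p = lookup⇒[]= i _ (≡.trans (lookup∘tabulate _ i) (dec-true (P? i) p))

      ∈⁻ : ∀ {i} → i ∈ˢ ⟦ P? ⟧ → P i
      ∈⁻ {i} i∈ with P? i | ≡.trans (≡.sym (lookup∘tabulate (does ∘ P?) i)) ([]=⇒lookup i∈)
      ... | yes p | _ = p
      ... | no  _ | ()

    -- A set that is closed under F and contained in every predicate closed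
    -- under F.

    module _ {N} (F : Subset N → Subset N) where

      Below : Subset N → Set₁
      Below A = (P : Pred (Fin N) 0ℓ) →
                (∀ B → (∀ {i} → i ∈ˢ B → P i) → ∀ {i} → i ∈ˢ F B → P i) →
                ∀ {i} → i ∈ˢ A → P i

      LeastFixedPoint : Set₁
      LeastFixedPoint = ∃[ A ] F A ⊆ˢ A × Below A

      leastFixedPoint : LeastFixedPoint
      leastFixedPoint = go ⊥ (λ _ _ i∈⊥ → contradiction i∈⊥ ∉⊥) (<-wellFounded _)
        where
        go : ∀ A → Below A → Acc ℕ._<_ (N ℕ.∸ ∣ A ∣) → LeastFixedPoint
        go A below (acc rec) with F A ⊆? A
        ... | yes closed = A , closed , below
        ... | no ¬closed with any? (λ i → (i ∈ˢ? F A) ×-dec ¬? (i ∈ˢ? A))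
        ...   | no none = contradiction
                (λ {i} i∈ → decidable-stable (i ∈ˢ? A) (λ i∉ → none (i , i∈ , i∉))) ¬closed
        ...   | yes (i , i∈FA , i∉A) = go (A ∪ F A)
                (λ P cl → [ below P cl , cl A (below P cl) ]′ ∘ x∈p∪q⁻ A (F A))
                (rec (ℕ.∸-monoʳ-< (p⊂q⇒∣p∣<∣q∣ (p⊆p∪q (F A) , i , q⊆p∪q A (F A) i∈FA , i∉A))
                                  (∣p∣≤n (A ∪ F A))))

    Σ-True? : ∀ {A : Set} (a? : Dec A) {B : True a? → Set} → (∀ t → Dec (B t)) → Dec (Σ (True a?) B)
    Σ-True? (yes _) b? = map′ (tt ,_) proj₂ (b? tt)
    Σ-True? (no _)  b? = no proj₁

    least : {P : Pred ℕ 0ℓ} → Decidable P → ∀ n → P n → ∃[ m ] P m × ∀ k → P k → m ℕ.≤ k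
    least {P} P? n p = go n p (<-wellFounded n)
      where
      go : ∀ n → P n → Acc ℕ._<_ n → ∃[ m ] P m × ∀ k → P k → m ℕ.≤ k
      go n p (acc rec) with ℕ.anyUpTo? P? n
      ... | yes (k , k<n , q) = go k q (rec k<n)
      ... | no none = n , p , λ k q → ℕ.≮⇒≥ (λ k<n → none (k , k<n , q))

    greatest : {P : Pred ℕ 0ℓ} → Decidable P → ∀ b → (∀ k → P k → k ℕ.≤ b) →
               (∃[ m ] P m × ∀ k → P k → k ℕ.≤ m) ⊎ (∀ k → ¬ P k)
    greatest {P} P? b bound with P? b
    ... | yes p = inj₁ (b , p , bound)
    greatest {P} P? zero    bound | no ¬p = inj₂ λ k p → ¬p (subst P (ℕ.n≤0⇒n≡0 (bound k p)) p)
    greatest {P} P? (suc b) bound | no ¬p = greatest P? b λ k p →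
      ℕ.≤-pred (ℕ.≤∧≢⇒< (bound k p) λ { refl → ¬p p })

  open Finite

  module GroupDec (G : FiniteAbelianGroup) where
    open FiniteAbelianGroup G renaming (refl to ≈-refl)
    open Inverse enumeration using (to; from; to-cong; from-cong)
      renaming (strictlyInverseˡ to to∘from; strictlyInverseʳ to from∘to)

    infix 4 _≈?_ _∈?_
    _≈?_ : ∀ x y → Dec (x ≈ y)
    x ≈? y = map′ (λ eq → trans (sym (from∘to x)) (trans (from-cong eq) (from∘to y))) to-cong (to x ≟ to y)

    _∈?_ : ∀ x A → Dec (x ∈ A)
    x ∈? A = to x ∈ˢ? A

    ∈-resp : ∀ {A x y} → x ≈ y → x ∈ A → y ∈ A
    ∈-resp {A} x≈y = subst (_∈ˢ A) (to-cong x≈y)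

    Respects : Pred Carrier 0ℓ → Set
    Respects P = ∀ {x y} → x ≈ y → P x → P y

    exists? : ∀ {P} → Respects P → Decidable P → Dec (∃[ x ] P x)
    exists? P-resp P? = map′ (λ (i , p) → from i , p) (λ (x , p) → to x , P-resp (sym (from∘to x)) p)
                           (any? (P? ∘ from))

    forall? : ∀ {P} → Respects P → Decidable P → Dec (∀ x → P x)
    forall? P-resp P? = map′ (λ p x → P-resp (from∘to x) (p (to x))) (λ p i → p (from i)) (all? (P? ∘ from))

    module SpanDec (A : Subset order) where

      Next : Subset order → Pred (Fin order) 0ℓ
      Next B i = i ∈ˢ A ⊎ i ≡ to 0#
               ⊎ (∃[ j ] ∃[ k ] j ∈ˢ B × k ∈ˢ B × i ≡ to (from j + from k))
               ⊎ (∃[ j ] j ∈ˢ B × i ≡ to (- from j))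

      next? : ∀ B → Decidable (Next B)
      next? B i = (i ∈ˢ? A) ⊎-dec (i ≟ _)
        ⊎-dec any? (λ j → any? λ k → (j ∈ˢ? B) ×-dec (k ∈ˢ? B) ×-dec (i ≟ _))
        ⊎-dec any? (λ j → (j ∈ˢ? B) ×-dec (i ≟ _))

      lfp : LeastFixedPoint (λ B → ⟦ next? B ⟧)
      lfp = leastFixedPoint _

      C : Subset order
      C = proj₁ lfp

      sound : ∀ {i} → i ∈ˢ C → Span A (from i)
      sound = proj₂ (proj₂ lfp) (Span A ∘ from) (λ B ih → step B ih ∘ ∈⁻ (next? B))
        where
        step : ∀ B → (∀ {i} → i ∈ˢ B → Span A (from i)) → ∀ {i} → Next B i → Span A (from i)
        step B ih {i} (inj₁ i∈A) = gen (subst (_∈ˢ A) (≡.sym (to∘from i)) i∈A)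
        step B ih (inj₂ (inj₁ refl)) = resp (sym (from∘to _)) zero
        step B ih (inj₂ (inj₂ (inj₁ (j , k , j∈ , k∈ , refl)))) =
          resp (sym (from∘to _)) (add (ih j∈) (ih k∈))
        step B ih (inj₂ (inj₂ (inj₂ (j , j∈ , refl)))) = resp (sym (from∘to _)) (neg (ih j∈))

      closed : ∀ {i} → Next C i → i ∈ˢ C
      closed = proj₁ (proj₂ lfp) ∘ ∈⁺ (next? C)

      complete : ∀ {x} → Span A x → to x ∈ˢ C
      complete (gen x∈)  = closed (inj₁ x∈)
      complete zero      = closed (inj₂ (inj₁ refl))
      complete (add p q) = closed (inj₂ (inj₂ (inj₁ (_ , _ , complete p , complete q ,
        to-cong (∙-cong (sym (from∘to _)) (sym (from∘to _)))))))
      complete (neg p)   = closed (inj₂ (inj₂ (inj₂ (_ , complete p , to-cong (⁻¹-cong (sym (from∘to _)))))))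
      complete (resp x≈y p) = subst (_∈ˢ C) (to-cong x≈y) (complete p)

    generates? : ∀ A → Dec (Generates A)
    generates? A = map′
      (λ f x → resp (from∘to x) (sound (f (to x))))
      (λ f i → subst (_∈ˢ C) (to∘from i) (complete (f (from i))))
      (all? (_∈ˢ? C))
      where open SpanDec A

    symmetric? : ∀ A → Dec (Symmetric A)
    symmetric? A = map′ (λ (f , g) → (λ {x} → f x) , (λ {x} → g x)) (λ (f , g) → (λ x → f {x}) , (λ x → g {x}))
      (forall? (λ eq f y∈ → neg-resp eq (f (∈-resp (sym eq) y∈))) (λ x → (x ∈? A) →-dec neg? x)
       ×-dec
       forall? (λ eq f n → ∈-resp eq (f (neg-resp (sym eq) n))) (λ x → neg? x →-dec (x ∈? A)))
      where
      neg-resp : Respects (λ x → ∃[ a ] a ∈ A × x ≈ - a)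
      neg-resp eq (a , a∈ , e) = a , a∈ , trans (sym eq) e
      neg? : Decidable (λ x → ∃[ a ] a ∈ A × x ≈ - a)
      neg? x = exists? (λ eq (a∈ , e) → ∈-resp eq a∈ , trans e (⁻¹-cong eq))
                       (λ a → (a ∈? A) ×-dec (x ≈? - a))

  module GameDec (X : Triple) where
    open Triple X renaming (refl to ≈-refl)
    open Game X hiding (CopsWin; IsCopNumber)
    open GroupDec G
    open Inverse enumeration using (to; from; to-cong; from-cong)
      renaming (strictlyInverseˡ to to∘from; strictlyInverseʳ to from∘to)

    step-resp : ∀ {A x x′ y y′} → x ≈ x′ → y ≈ y′ → Step A x y → Step A x′ y′
    step-resp p q (inj₁ e)            = inj₁ (trans (sym q) (trans e p))
    step-resp p q (inj₂ (a , a∈ , e)) = inj₂ (a , a∈ , trans (sym q) (trans e (∙-congʳ p)))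

    step? : ∀ A x y → Dec (Step A x y)
    step? A x y = (y ≈? x) ⊎-dec exists? (λ eq (a∈ , e) → ∈-resp eq a∈ , trans e (∙-congˡ eq))
                                         (λ a → (a ∈? A) ×-dec (y ≈? x + a))

    module _ {m : ℕ} where

      _≋_ : Cops {m} → Cops {m} → Set
      x ≋ y = ∀ i → x i ≈ y i

      caught-resp : ∀ {x y r r′} → x ≋ y → r ≈ r′ → Caught x r → Caught y r′
      caught-resp p q (i , e) = i , trans (sym (p i)) (trans e q)

      caught? : ∀ (x : Cops {m}) r → Dec (Caught x r)
      caught? x r = any? (λ i → x i ≈? r)

      copTurn-resp    : ∀ {x y r r′} → x ≋ y → r ≈ r′ → CopTurn x r → CopTurn y r′
      robberTurn-resp : ∀ {x r r′} → r ≈ r′ → RobberTurn {m} x r → RobberTurn x r′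
      copTurn-resp p q (caught c)   = caught (caught-resp p q c)
      copTurn-resp p q (move z s w) = move z (λ i → step-resp (p i) ≈-refl (s i)) (robberTurn-resp q w)
      robberTurn-resp q (caught c) = caught (caught-resp (λ _ → ≈-refl) q c)
      robberTurn-resp q (move f)   = move λ r′ s → f r′ (step-resp (sym q) ≈-refl s)

      cops : Fin (order ℕ.^ m) → Cops {m}
      cops c i = from (finToFun c i)

      code : Cops {m} → Fin (order ℕ.^ m)
      code x = funToFin (to ∘ x)

      cops∘code : ∀ x → cops (code x) ≋ x
      cops∘code x i = trans (from-cong (finToFun-funToFin (to ∘ x) i)) (from∘to (x i))

      States : ℕ
      States = order ℕ.^ m ℕ.* order

      split : Fin States → Fin (order ℕ.^ m) × Fin order
      split = remQuot order

      Next′ : Subset States → Fin (order ℕ.^ m) → Fin order → Set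
      Next′ B c r = Caught (cops c) (from r)
        ⊎ (∃[ d ] (∀ i → Step S (cops c i) (cops d i))
            × (Caught (cops d) (from r) ⊎ (∀ r′ → Step T (from r) (from r′) → combine d r′ ∈ˢ B)))

      Next : Subset States → Pred (Fin States) 0ℓ
      Next B s = Next′ B (proj₁ (split s)) (proj₂ (split s))

      next? : ∀ B → Decidable (Next B)
      next? B s = caught? _ _
        ⊎-dec any? (λ d → all? (λ i → step? _ _ _)
            ×-dec (caught? _ _ ⊎-dec all? (λ r′ → step? _ _ _ →-dec (_ ∈ˢ? B))))

      lfp : LeastFixedPoint (λ B → ⟦ next? B ⟧)
      lfp = leastFixedPoint _

      W : Subset States
      W = proj₁ lfp

      Sound : Pred (Fin States) 0ℓ
      Sound s = CopTurn (cops (proj₁ (split s))) (from (proj₂ (split s)))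

      sound : ∀ {s} → s ∈ˢ W → Sound s
      sound = proj₂ (proj₂ lfp) Sound (λ B ih {s} s∈ → go B ih {s} (∈⁻ (next? B) s∈))
        where
        go : ∀ B → (∀ {s} → s ∈ˢ B → Sound s) → ∀ {s} → Next B s → Sound s
        go B ih (inj₁ c) = caught c
        go B ih (inj₂ (d , st , inj₁ c)) = move (cops d) st (caught c)
        go B ih (inj₂ (d , st , inj₂ f)) = move (cops d) st (move λ r′ s →
          let q = subst (λ (d , r) → CopTurn (cops d) (from r)) (remQuot-combine {order ℕ.^ m} d (to r′))
                    (ih {combine d (to r′)} (f (to r′) (step-resp ≈-refl (sym (from∘to r′)) s)))
          in copTurn-resp (λ _ → ≈-refl) (from∘to r′) q)

      closed : ∀ c r → Next′ W c r → combine c r ∈ˢ W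
      closed c r n = proj₁ (proj₂ lfp) (∈⁺ (next? W) {combine c r}
        (subst (λ (c , r) → Next′ W c r) (≡.sym (remQuot-combine {order ℕ.^ m} c r)) n))

      complete : ∀ {x r} → CopTurn x r → combine (code x) (to r) ∈ˢ W
      complete {x} {r} (caught c) = closed _ _ (inj₁
        (caught-resp (λ i → sym (cops∘code x i)) (sym (from∘to r)) c))
      complete {x} {r} (move y st (caught c)) = closed _ _ (inj₂ (code y ,
        (λ i → step-resp (sym (cops∘code x i)) (sym (cops∘code y i)) (st i)) ,
        inj₁ (caught-resp (λ i → sym (cops∘code y i)) (sym (from∘to r)) c)))
      complete {x} {r} (move y st (move f)) = closed _ _ (inj₂ (code y ,
        (λ i → step-resp (sym (cops∘code x i)) (sym (cops∘code y i)) (st i)) ,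
        inj₂ (λ r′ s → subst (λ r → combine (code y) r ∈ˢ W) (to∘from r′)
          (complete (f (from r′) (step-resp (from∘to r) ≈-refl s))))))

      copTurn? : ∀ x r → Dec (CopTurn x r)
      copTurn? x r = map′
        (λ ∈W → copTurn-resp (cops∘code x) (from∘to r)
          (subst (λ (c , r) → CopTurn (cops c) (from r)) (remQuot-combine {order ℕ.^ m} (code x) (to r)) (sound {combine (code x) (to r)} ∈W)))
        complete (combine (code x) (to r) ∈ˢ? W)

    copsWin? : ∀ m → Dec (CopsWin X m)
    copsWin? m = map′
      (λ (c , f) → cops c , f)
      (λ (x , f) → code x , λ r → copTurn-resp (λ i → sym (cops∘code x i)) ≈-refl (f r))
      (any? λ c → forall? (copTurn-resp (λ _ → ≈-refl)) (copTurn? (cops c)))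

    copsWin-order : CopsWin X order
    copsWin-order = from , λ r → caught (to r , from∘to r)

    copNumber : ∃[ m ] IsCopNumber X m
    copNumber = least copsWin? order copsWin-order

    isCopNumber? : ∀ m → Dec (IsCopNumber X m)
    isCopNumber? m = let (k , win , min) = copNumber in map′
      (λ { refl → win , min })
      (λ (win′ , min′) → ℕ.≤-antisym (min′ k win) (min m win′))
      (m ℕ.≟ k)

  𝒢? : ∀ κ X → Dec (𝒢 κ X)
  𝒢? directed   X = yes tt
  𝒢? undirected X = GroupDec.symmetric? G S
    where open Triple X

  -- A homomorphism with a two-sided inverse carries winning strategies over.

  module Transport (X Y : Triple) where
    private
      module X = Triple X
      module Y = Triple Y
      module GX = Game X
      module GY = Game Y

    module _ (φ : X.Carrier → Y.Carrier) (ψ : Y.Carrier → X.Carrier)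
             (φ-cong : ∀ {x y} → x X.≈ y → φ x Y.≈ φ y) (ψ-cong : ∀ {x y} → x Y.≈ y → ψ x X.≈ ψ y)
             (φψ : ∀ y → φ (ψ y) Y.≈ y) (ψφ : ∀ x → ψ (φ x) X.≈ x)
             (φ-+ : ∀ x y → φ (x X.+ y) Y.≈ φ x Y.+ φ y) (ψ-+ : ∀ x y → ψ (x Y.+ y) X.≈ ψ x X.+ ψ y)
             (φ-S : ∀ {x} → x X.∈ X.S → φ x Y.∈ Y.S) (ψ-T : ∀ {x} → x Y.∈ Y.T → ψ x X.∈ X.T) where

      φ-step : ∀ {x y} → GX.Step X.S x y → GY.Step Y.S (φ x) (φ y)
      φ-step (inj₁ e)            = inj₁ (φ-cong e)
      φ-step (inj₂ (a , a∈ , e)) = inj₂ (φ a , φ-S a∈ , Y.trans (φ-cong e) (φ-+ _ _))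

      ψ-step : ∀ {x y} → GY.Step Y.T x y → GX.Step X.T (ψ x) (ψ y)
      ψ-step (inj₁ e)            = inj₁ (ψ-cong e)
      ψ-step (inj₂ (a , a∈ , e)) = inj₂ (ψ a , ψ-T a∈ , X.trans (ψ-cong e) (ψ-+ _ _))

      φ-copTurn    : ∀ {m x r} → GX.CopTurn {m} x r → GY.CopTurn (φ ∘ x) (φ r)
      φ-robberTurn : ∀ {m x r} → GX.RobberTurn {m} x r → GY.RobberTurn (φ ∘ x) (φ r)
      φ-copTurn (GX.caught (i , e)) = GY.caught (i , φ-cong e)
      φ-copTurn (GX.move y st w)    = GY.move (φ ∘ y) (φ-step ∘ st) (φ-robberTurn w)
      φ-robberTurn (GX.caught (i , e)) = GY.caught (i , φ-cong e)
      φ-robberTurn (GX.move f) = GY.move λ r′ s → GameDec.copTurn-resp Y (λ _ → Y.refl) (φψ r′)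
        (φ-copTurn (f (ψ r′) (GameDec.step-resp X (ψφ _) X.refl (ψ-step s))))

      φ-copsWin : ∀ m → CopsWin X m → CopsWin Y m
      φ-copsWin m (x , f) = φ ∘ x , λ r →
        GameDec.copTurn-resp Y (λ _ → Y.refl) (φψ r) (φ-copTurn (f (ψ r)))

  -- Abelian groups with carrier Fin n, coded by their operation tables.

  module Model (n : ℕ) where

    module _ (op : Fin ((n ℕ.^ n) ℕ.^ n)) (z : Fin n) (inv : Fin (n ℕ.^ n)) where

      infixl 6 _⊕_
      _⊕_ : Fin n → Fin n → Fin n
      i ⊕ j = finToFun (finToFun op i) j

      ⊖_ : Fin n → Fin n
      ⊖_ = finToFun inv

      Laws : Set
      Laws = (∀ i j k → (i ⊕ j) ⊕ k ≡ i ⊕ (j ⊕ k)) × (∀ i j → i ⊕ j ≡ j ⊕ i)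
           × (∀ i → z ⊕ i ≡ i) × (∀ i → ⊖ i ⊕ i ≡ z)

      laws? : Dec Laws
      laws? = all? (λ i → all? λ j → all? λ k → _ ≟ _) ×-dec all? (λ i → all? λ j → _ ≟ _)
        ×-dec all? (λ i → _ ≟ _) ×-dec all? (λ i → _ ≟ _)

      isAbelianGroup : Laws → IsAbelianGroup _≡_ _⊕_ z ⊖_
      isAbelianGroup (assoc , comm , idˡ , invˡ) = record
        { isGroup = record
          { isMonoid = record
            { isSemigroup = record
              { isMagma = record { isEquivalence = ≡.isEquivalence ; ∙-cong = cong₂ _⊕_ }
              ; assoc   = assoc
              }
            ; identity = idˡ , λ i → ≡.trans (comm i z) (idˡ i)
            }
          ; inverse = invˡ , λ i → ≡.trans (comm i (⊖ i)) (invˡ i)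
          ; ⁻¹-cong = cong ⊖_
          }
        ; comm = comm
        }

      modelGroup : True laws? → FiniteAbelianGroup
      modelGroup l = record
        { abelianGroup = record { isAbelianGroup = isAbelianGroup (toWitness l) }
        ; order        = n
        ; enumeration  = idInverse (≡.setoid (Fin n))
        }

      module _ (l : True laws?) (S T : Subset n) where
        open FiniteAbelianGroup (modelGroup l) using (Generates; _∈_; 0#)

        IsTriple : Set
        IsTriple = Generates S × ¬ (0# ∈ S) × T ⊆ˢ S

        isTriple? : Dec IsTriple
        isTriple? = GroupDec.generates? (modelGroup l) S ×-dec ¬? (z ∈ˢ? S) ×-dec (T ⊆? S)

        triple : True isTriple? → Triple
        triple t = let (gen , 0∉ , T⊆) = toWitness t in record
          { G = modelGroup l ; S = S ; T = T ; generates = gen ; 0∉S = 0∉ ; T⊆S = T⊆ }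

    Candidate : Kind → ℕ × ℕ × ℕ → ℕ → Set
    Candidate κ p m = ∃[ op ] ∃[ z ] ∃[ inv ] Σ (True (laws? op z inv)) λ l → ∃[ S ] ∃[ T ]
      Σ (True (isTriple? op z inv l S T)) λ t →
      let X = triple op z inv l S T t in 𝒢 κ X × Triple.card X ≡ p × IsCopNumber X m

    candidate? : ∀ κ p m → Dec (Candidate κ p m)
    candidate? κ p m = any? λ op → any? λ z → any? λ inv → Σ-True? (laws? op z inv) λ l →
      anySubset? λ S → anySubset? λ T → Σ-True? (isTriple? op z inv l S T) λ t →
      let X = triple op z inv l S T t in
      𝒢? κ X ×-dec ≡-dec ℕ._≟_ (≡-dec ℕ._≟_ ℕ._≟_) (Triple.card X) p ×-dec GameDec.isCopNumber? X m

  module _ (X : Triple) where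
    open Triple X renaming (refl to ≈-refl)
    open Inverse enumeration using (to; from; to-cong; from-cong)
      renaming (strictlyInverseˡ to to∘from; strictlyInverseʳ to from∘to)
    open Model order

    private
      _⊞_ : Fin order → Fin order → Fin order
      i ⊞ j = to (from i + from j)

      op : Fin ((order ℕ.^ order) ℕ.^ order)
      op = funToFin (λ i → funToFin (i ⊞_))

      z : Fin order
      z = to 0#

      inv : Fin (order ℕ.^ order)
      inv = funToFin (λ i → to (- from i))

      infixl 6 _+′_
      _+′_ : Fin order → Fin order → Fin order
      _+′_ = _⊕_ op z inv

      -′_ : Fin order → Fin order
      -′_ = ⊖_ op z inv

      op≡ : ∀ i j → i +′ j ≡ to (from i + from j)
      op≡ i j = ≡.trans
        (cong (λ c → finToFun c j) (finToFun-funToFin (λ i → funToFin (i ⊞_)) i))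
        (finToFun-funToFin (i ⊞_) j)

      from-op : ∀ i j → from (i +′ j) ≈ from i + from j
      from-op i j = trans (from-cong (op≡ i j)) (from∘to _)

      from-inv : ∀ i → from (-′ i) ≈ - from i
      from-inv i = trans (from-cong (finToFun-funToFin (λ i → to (- from i)) i)) (from∘to _)

      to-+ : ∀ x y → to (x + y) ≡ to x +′ to y
      to-+ x y = ≡.trans (to-cong (∙-cong (sym (from∘to x)) (sym (from∘to y)))) (≡.sym (op≡ _ _))

      to-neg : ∀ x → to (- x) ≡ -′ to x
      to-neg x = ≡.trans (to-cong (⁻¹-cong (sym (from∘to x))))
                         (≡.sym (finToFun-funToFin (λ i → to (- from i)) (to x)))

      from-inj : ∀ {i j} → from i ≈ from j → i ≡ j
      from-inj e = ≡.trans (≡.sym (to∘from _)) (≡.trans (to-cong e) (to∘from _))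

      laws : Laws op z inv
      laws = (λ i j k → from-inj (trans (from-op _ _) (trans (∙-congʳ (from-op _ _)) (trans (assoc _ _ _)
                (sym (trans (from-op _ _) (∙-congˡ (from-op _ _))))))))
           , (λ i j → from-inj (trans (from-op _ _) (trans (comm _ _) (sym (from-op _ _)))))
           , (λ i → from-inj (trans (from-op _ _) (trans (∙-congʳ (from∘to _)) (identityˡ _))))
           , (λ i → from-inj (trans (from-op _ _) (trans (∙-congʳ (from-inv _)) (trans (inverseˡ _) (sym (from∘to _))))))

      l : True (laws? op z inv)
      l = fromWitness laws

      module M = FiniteAbelianGroup (modelGroup op z inv l)

      span : ∀ {x} → Span S x → M.Span S (to x)
      span (gen x∈)     = M.gen x∈
      span zero         = M.zero
      span (add p q)    = M.resp (≡.sym (to-+ _ _)) (M.add (span p) (span q))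
      span (neg p)      = M.resp (≡.sym (to-neg _)) (M.neg (span p))
      span (resp x≈y p) = M.resp (to-cong x≈y) (span p)

      t : True (isTriple? op z inv l S T)
      t = fromWitness ((λ i → subst (M.Span S) (to∘from i) (span (generates (from i)))) , 0∉S , (λ {i} → T⊆S {i}))

      Y : Triple
      Y = triple op z inv l S T t

      from-∈ : ∀ {A i} → i ∈ˢ A → from i ∈ A
      from-∈ {A} {i} = subst (_∈ˢ A) (≡.sym (to∘from i))

      𝒢-Y : ∀ κ → 𝒢 κ X → 𝒢 κ Y
      𝒢-Y directed   _       = tt
      𝒢-Y undirected (f , g) =
          (λ {i} i∈ → let (a , a∈ , e) = f (from-∈ i∈) in
            to a , a∈ , ≡.trans (≡.sym (to∘from i)) (≡.trans (to-cong e) (to-neg a)))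
        , (λ {i} (a , a∈ , e) → subst (_∈ˢ S) (to∘from i)
            (g (from a , from-∈ a∈ , trans (from-cong e) (from-inv a))))

      X⇒Y : ∀ m → CopsWin X m → CopsWin Y m
      X⇒Y = Transport.φ-copsWin X Y to from to-cong from-cong to∘from from∘to to-+ from-op id from-∈

      Y⇒X : ∀ m → CopsWin Y m → CopsWin X m
      Y⇒X = Transport.φ-copsWin Y X from to from-cong to-cong from∘to to∘from from-op to-+ from-∈ id

    candidate : ∀ κ {m} → 𝒢 κ X → IsCopNumber X m → Candidate κ card m
    candidate κ X∈ (win , min) = op , z , inv , l , S , T , t , 𝒢-Y κ X∈ , refl ,
      X⇒Y _ win , λ k → min k ∘ Y⇒X k

  abstract
    maxCopNumber : ∀ κ p → ∃[ m ] IsMaxCopNumber κ p m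
    maxCopNumber κ p@(n , _) with greatest (Model.candidate? n κ p) n
        (λ { _ (_ , _ , _ , _ , _ , _ , _ , _ , refl , _ , min) → min n (GameDec.copsWin-order _) })
    ... | inj₁ (m , (_ , _ , _ , _ , _ , _ , _ , X∈ , eq , isCop) , max) =
      m , inj₁ ((_ , X∈ , eq , isCop) , λ { X X∈ refl k isCop → max k (candidate X κ X∈ isCop) })
    ... | inj₂ none =
      1 , inj₂ ((λ { (X , X∈ , refl) → none _ (candidate X κ X∈ (proj₂ (GameDec.copNumber X))) }) , refl)

open Existence public using (maxCopNumber)

-- c directed is c_d, c undirected is c_u.

c : Kind → 𝒟 → ℕ
c κ d = proj₁ (maxCopNumber κ (value d))

c-isMaxCopNumber : ∀ κ d → IsMaxCopNumber κ (value d) (c κ d)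
c-isMaxCopNumber κ d = proj₂ (maxCopNumber κ (value d))

{-# OPTIONS --safe #-}

-- Let k account for the set A ⊆ T.  A cop x with r − x in the subgroup ⟨k⟩ can
-- keep it there: it copies the robber's moves outside A and answers a ∈ A by
-- a − k, which adds k to r − x.  So the robber can move in A only boundedly often
-- before this cop catches him.  Hence c(G, S, T) is at most the maximum of the
-- cop number of the quotient by ⟨k⟩, which suffices to bring one cop into the
-- coset of the robber, and of 1 + c(G, S, T ∖ A): after each move in A the other
-- cops return to their starting positions and play against T ∖ A afresh.  The
-- bound follows by induction on n + t.

module Submission where

open import Defs
import Algebra.Properties.AbelianGroup
import Algebra.Properties.CommutativeSemigroup
import Algebra.Properties.Monoid.Mult
open import Data.Bool.Base using (true; false)
open import Data.Fin.Base as Fin using (Fin; zero; suc; toℕ; combine; remQuot; punchIn; punchOut)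
import Data.Fin.Properties as Fin
open import Data.Fin.Subset using (Subset; ∣_∣; _∪_; _─_; ∁; ⊥; ⁅_⁆) renaming (_∈_ to _∈ˢ_; _⊆_ to _⊆ˢ_; _∉_ to _∉ˢ_)
import Data.Fin.Subset.Properties as Sub
open import Data.Integer.Base as ℤ using (+_)
import Data.Integer.Properties as ℤ
import Data.Integer.Solver as ℤ-Solver
open import Data.Irrelevant using ([_])
open import Data.Nat.Base as ℕ using (ℕ; zero; suc; _*_; _≤_; s≤s; z≤n)
open import Data.Nat.Induction using (<-wellFounded)
import Data.Nat.Properties as ℕ
import Data.Nat.Solver as ℕ-Solver
open import Data.Product.Base using (_×_; _,_; ∃-syntax; proj₁; proj₂)
open import Data.Rational.Unnormalised.Base as ℚᵘ using (mkℚᵘ; *≡*; *≤*)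
import Data.Rational.Unnormalised.Properties as ℚᵘ
open import Data.Rational.Unnormalised.Solver using (module +-*-Solver)
open import Data.Refinement.Base using (value; _,_)
open import Data.Sum.Base using (_⊎_; inj₁; inj₂; [_,_]′)
open import Data.Unit.Base using (tt)
open import Data.Vec.Base using ([]; _∷_; here; there)
open import Data.Vec.Functional using (insertAt)
open import Data.Vec.Functional.Properties using (insertAt-lookup; insertAt-punchIn)
open import Function.Base using (_∘_)
open import Function.Bundles using (Inverse)
open import Induction.WellFounded using (Acc; acc)
open import Level using (0ℓ)
import Relation.Binary.Construct.On as On
open import Relation.Binary.Definitions using (Decidable)
open import Relation.Binary.PropositionalEquality as ≡ using (_≡_; _≢_; cong; subst)
import Relation.Binary.Reasoning.Setoid
open import Relation.Binary.Structures using (IsEquivalence)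
open import Relation.Nullary.Decidable using (Dec; yes; no; map′; _⊎-dec_; _×-dec_; ¬?; recompute)
open import Relation.Nullary.Negation.Core using (¬_; contradiction)
open import Relation.Unary using (Pred)

open Existence using (module GroupDec; module GameDec)
open Real using (seq; regular; 1/1+_; 2/1+_)

-- Natural numbers compared with Bishop reals.

fromℕ-antitone : ∀ {m n} y → m ℕ.≤ n → fromℕ n ≤ᴿ y → fromℕ m ≤ᴿ y
fromℕ-antitone y m≤n n≤y i = ℚᵘ.≤-trans (*≤* (ℤ.*-monoʳ-≤-nonNeg (+ 1) (ℤ.+≤+ m≤n))) (n≤y i)

integer-+ : ∀ i j → mkℚᵘ (i ℤ.+ j) 0 ℚᵘ.≃ mkℚᵘ i 0 ℚᵘ.+ mkℚᵘ j 0
integer-+ i j = *≡* (lemma i j)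
  where
  open ℤ-Solver.+-*-Solver
  lemma : ∀ i j → (i ℤ.+ j) ℤ.* + 1 ≡ (i ℤ.* + 1 ℤ.+ j ℤ.* + 1) ℤ.* + 1
  lemma = solve 2 (λ i j → (i :+ j) :* con (+ 1) := (i :* con (+ 1) :+ j :* con (+ 1)) :* con (+ 1)) ≡.refl

p≤∣p∣ : ∀ p → p ℚᵘ.≤ ℚᵘ.∣ p ∣
p≤∣p∣ p with ℚᵘ.≤-total ℚᵘ.0ℚᵘ p
... | inj₁ 0≤p = ℚᵘ.≤-reflexive (ℚᵘ.≃-sym (ℚᵘ.0≤p⇒∣p∣≃p 0≤p))
... | inj₂ p≤0 = ℚᵘ.≤-trans p≤0 (ℚᵘ.0≤∣p∣ p)

1+1/1+n≃2/1+n : ∀ n → 1/1+ n ℚᵘ.+ 1/1+ n ℚᵘ.≃ 2/1+ n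
1+1/1+n≃2/1+n n = *≡* (cong +_ (lemma n))
  where
  open ℕ-Solver.+-*-Solver
  lemma : ∀ n → (1 ℕ.* suc n ℕ.+ 1 ℕ.* suc n) ℕ.* suc n ≡ 2 ℕ.* (suc n ℕ.* suc n)
  lemma = solve 1 (λ n → let d = con 1 :+ n in (con 1 :* d :+ con 1 :* d) :* d := con 2 :* (d :* d)) ≡.refl

-- `_+ᴿ_` samples its summands at index 2n + 1, where the permitted error is smaller than at `n`.
2/1+-antitone : ∀ n → 2/1+ (suc (2 ℕ.* n)) ℚᵘ.≤ 2/1+ n
2/1+-antitone n = *≤* (ℤ.+≤+ (ℕ.*-monoʳ-≤ 2 (s≤s (ℕ.m≤n⇒m≤1+n (ℕ.m≤n*m n 2)))))

5/[5+5n]≃1/1+n : ∀ n → mkℚᵘ (+ 5) (4 ℕ.+ 5 ℕ.* n) ℚᵘ.≃ 1/1+ n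
5/[5+5n]≃1/1+n n = *≡* (cong +_ (lemma n))
  where
  open ℕ-Solver.+-*-Solver
  lemma : ∀ n → 5 ℕ.* suc n ≡ 1 ℕ.* (5 ℕ.+ 5 ℕ.* n)
  lemma = solve 1 (λ n → con 5 :* (con 1 :+ n) := con 1 :* (con 5 :+ con 5 :* n)) ≡.refl

1+2+2/1+n≃5/1+n : ∀ n → 1/1+ n ℚᵘ.+ (2/1+ n ℚᵘ.+ 2/1+ n) ℚᵘ.≃ mkℚᵘ (+ 5) n
1+2+2/1+n≃5/1+n n = *≡* (cong +_ (lemma n))
  where
  open ℕ-Solver.+-*-Solver
  lemma : ∀ n → (1 ℕ.* (suc n ℕ.* suc n) ℕ.+ (2 ℕ.* suc n ℕ.+ 2 ℕ.* suc n) ℕ.* suc n) ℕ.* suc n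
            ≡ 5 ℕ.* (suc n ℕ.* (suc n ℕ.* suc n))
  lemma = solve 1 (λ n → let d = con 1 :+ n in
    (con 1 :* (d :* d) :+ (con 2 :* d :+ con 2 :* d) :* d) :* d := con 5 :* (d :* (d :* d))) ≡.refl

-- Comparing at the index 5n + 4 costs 5 / (5n + 5) = 1 / (n + 1), and
-- returning to the index n costs another 1 / (n + 1).

fromℕ-≤-trans : ∀ {m} y z → fromℕ m ≤ᴿ y → y ≤ᴿ z → fromℕ m ≤ᴿ z
fromℕ-≤-trans {m} y z m≤y y≤z n = begin
  mkℚᵘ (+ m) 0                                   ≤⟨ m≤y k ⟩
  seq y k ℚᵘ.+ w                                 ≤⟨ ℚᵘ.+-monoˡ-≤ w (y≤z k) ⟩
  seq z k ℚᵘ.+ w ℚᵘ.+ w                          ≃⟨ split (seq z k) (seq z n) w ⟩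
  seq z n ℚᵘ.+ ((seq z k ℚᵘ.- seq z n) ℚᵘ.+ (w ℚᵘ.+ w))
    ≤⟨ ℚᵘ.+-monoʳ-≤ (seq z n) (ℚᵘ.+-monoˡ-≤ (w ℚᵘ.+ w) (ℚᵘ.≤-trans (p≤∣p∣ _) (regular z k n))) ⟩
  seq z n ℚᵘ.+ ((1/1+ k ℚᵘ.+ 1/1+ n) ℚᵘ.+ (w ℚᵘ.+ w))
    ≃⟨ ℚᵘ.+-congʳ (seq z n) (shuffle (1/1+ k) (1/1+ n) (w ℚᵘ.+ w)) ⟩
  seq z n ℚᵘ.+ ((1/1+ k ℚᵘ.+ (w ℚᵘ.+ w)) ℚᵘ.+ 1/1+ n)
    ≃⟨ ℚᵘ.+-congʳ (seq z n) (ℚᵘ.+-congˡ (1/1+ n) (ℚᵘ.≃-trans (1+2+2/1+n≃5/1+n k) (5/[5+5n]≃1/1+n n))) ⟩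
  seq z n ℚᵘ.+ (1/1+ n ℚᵘ.+ 1/1+ n)              ≃⟨ ℚᵘ.+-congʳ (seq z n) (1+1/1+n≃2/1+n n) ⟩
  seq z n ℚᵘ.+ 2/1+ n                            ∎
  where
  open ℚᵘ.≤-Reasoning
  k = 4 ℕ.+ 5 ℕ.* n
  w = 2/1+ k
  open +-*-Solver
  split : ∀ a b w → a ℚᵘ.+ w ℚᵘ.+ w ℚᵘ.≃ b ℚᵘ.+ ((a ℚᵘ.- b) ℚᵘ.+ (w ℚᵘ.+ w))
  split = solve 3 (λ a b w → a :+ w :+ w := b :+ ((a :- b) :+ (w :+ w))) ℚᵘ.≃-refl
  shuffle : ∀ u v w → (u ℚᵘ.+ v) ℚᵘ.+ w ℚᵘ.≃ (u ℚᵘ.+ w) ℚᵘ.+ v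
  shuffle = solve 3 (λ u v w → (u :+ v) :+ w := (u :+ w) :+ v) ℚᵘ.≃-refl

fromℕ-suc-≤ : ∀ {m} y → fromℕ m ≤ᴿ y → fromℕ (suc m) ≤ᴿ y +ᴿ fromℕ 1
fromℕ-suc-≤ {m} y m≤y n = begin
  mkℚᵘ (+ suc m) 0                        ≃⟨ integer-+ (+ 1) (+ m) ⟩
  1ℚ ℚᵘ.+ mkℚᵘ (+ m) 0                    ≤⟨ ℚᵘ.+-monoʳ-≤ 1ℚ (m≤y (suc (2 ℕ.* n))) ⟩
  1ℚ ℚᵘ.+ (Y ℚᵘ.+ 2/1+ (suc (2 ℕ.* n)))   ≤⟨ ℚᵘ.+-monoʳ-≤ 1ℚ (ℚᵘ.+-monoʳ-≤ Y (2/1+-antitone n)) ⟩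
  1ℚ ℚᵘ.+ (Y ℚᵘ.+ 2/1+ n)                 ≃⟨ shuffle 1ℚ Y (2/1+ n) ⟩
  Y ℚᵘ.+ 1ℚ ℚᵘ.+ 2/1+ n                   ∎
  where
  open ℚᵘ.≤-Reasoning
  1ℚ = mkℚᵘ (+ 1) 0
  Y = seq y (suc (2 ℕ.* n))
  open +-*-Solver
  shuffle : ∀ u v w → u ℚᵘ.+ (v ℚᵘ.+ w) ℚᵘ.≃ (v ℚᵘ.+ u) ℚᵘ.+ w
  shuffle = solve 3 (λ u v w → u :+ (v :+ w) := (v :+ u) :+ w) ℚᵘ.≃-refl

-- With `m`, `n`, `t` the sizes of `T ─ A`, `A`, `T`, this brings `T ─ A` into the range of
-- `restrictions`. Naturals have exact terms, so the only error is that of `h` at index 2i + 1.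
fromℕ-∸-≤ : ∀ {m n t} h → m ℕ.+ n ≡ t → h ≤ᴿ fromℕ n → fromℕ m ≤ᴿ fromℕ t -ᴿ h
fromℕ-∸-≤ {m} {n} h ≡.refl h≤n i = begin
  M                                              ≃⟨ expand M N ⟩
  (M ℚᵘ.+ N) ℚᵘ.- N                              ≃⟨ cancel M N H ⟩
  (M ℚᵘ.+ N ℚᵘ.- H) ℚᵘ.+ (H ℚᵘ.- N)              ≤⟨ ℚᵘ.+-monoʳ-≤ (M ℚᵘ.+ N ℚᵘ.- H) H-N≤ ⟩
  (M ℚᵘ.+ N ℚᵘ.- H) ℚᵘ.+ 2/1+ i                  ≃⟨ ℚᵘ.+-congˡ (2/1+ i) (ℚᵘ.+-congˡ (ℚᵘ.- H) (integer-+ (+ m) (+ n))) ⟨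
  mkℚᵘ (+ (m ℕ.+ n)) 0 ℚᵘ.- H ℚᵘ.+ 2/1+ i        ∎
  where
  open ℚᵘ.≤-Reasoning
  M = mkℚᵘ (+ m) 0
  N = mkℚᵘ (+ n) 0
  H = seq h (suc (2 ℕ.* i))
  open +-*-Solver
  expand : ∀ a b → a ℚᵘ.≃ (a ℚᵘ.+ b) ℚᵘ.- b
  expand = solve 2 (λ a b → a := (a :+ b) :- b) ℚᵘ.≃-refl
  cancel : ∀ a b c → (a ℚᵘ.+ b) ℚᵘ.- b ℚᵘ.≃ (a ℚᵘ.+ b ℚᵘ.- c) ℚᵘ.+ (c ℚᵘ.- b)
  cancel = solve 3 (λ a b c → (a :+ b) :- b := (a :+ b :- c) :+ (c :- b)) ℚᵘ.≃-refl
  back : ∀ a b → (a ℚᵘ.+ b) ℚᵘ.- a ℚᵘ.≃ b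
  back = solve 2 (λ a b → (a :+ b) :- a := b) ℚᵘ.≃-refl
  H-N≤ : H ℚᵘ.- N ℚᵘ.≤ 2/1+ i
  H-N≤ = begin
    H ℚᵘ.- N                                  ≤⟨ ℚᵘ.+-monoˡ-≤ (ℚᵘ.- N) (h≤n (suc (2 ℕ.* i))) ⟩
    N ℚᵘ.+ 2/1+ (suc (2 ℕ.* i)) ℚᵘ.- N        ≃⟨ back N (2/1+ (suc (2 ℕ.* i))) ⟩
    2/1+ (suc (2 ℕ.* i))                      ≤⟨ 2/1+-antitone i ⟩
    2/1+ i                                    ∎

-- The index that separates `h` from 0 refutes `h ≤ᴿ fromℕ 0`. This makes `A` nonempty, so that
-- removing it from `T` lowers the induction measure.
positive-≤⇒0< : ∀ {n} h → fromℕ 0 <ᴿ h → h ≤ᴿ fromℕ n → 0 ℕ.< n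
positive-≤⇒0< {zero}  h (i , 0<h) h≤n = contradiction (h≤n i) (ℚᵘ.<⇒≱ 0<h)
positive-≤⇒0< {suc n} h 0<h       h≤n = ℕ.z<s

-- Cardinalities and images of finite subsets.

∣p∪q∣≤∣p∣+∣q∣ : ∀ {n} (p q : Subset n) → ∣ p ∪ q ∣ ≤ ∣ p ∣ ℕ.+ ∣ q ∣
∣p∪q∣≤∣p∣+∣q∣ []          []          = z≤n
∣p∪q∣≤∣p∣+∣q∣ (true ∷ p)  (y ∷ q)     = s≤s (ℕ.≤-trans (∣p∪q∣≤∣p∣+∣q∣ p q) (ℕ.+-monoʳ-≤ ∣ p ∣ (Sub.∣p∣≤∣x∷p∣ y q)))
∣p∪q∣≤∣p∣+∣q∣ (false ∷ p) (true ∷ q)  = ℕ.≤-trans (s≤s (∣p∪q∣≤∣p∣+∣q∣ p q)) (ℕ.≤-reflexive (≡.sym (ℕ.+-suc ∣ p ∣ ∣ q ∣)))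
∣p∪q∣≤∣p∣+∣q∣ (false ∷ p) (false ∷ q) = ∣p∪q∣≤∣p∣+∣q∣ p q

∣p─q∣+∣q∣≡∣p∣ : ∀ {n} (p q : Subset n) → q ⊆ˢ p → ∣ p ─ q ∣ ℕ.+ ∣ q ∣ ≡ ∣ p ∣
∣p─q∣+∣q∣≡∣p∣ []          []          q⊆p = ≡.refl
∣p─q∣+∣q∣≡∣p∣ (true ∷ p)  (true ∷ q)  q⊆p =
  ≡.trans (ℕ.+-suc ∣ p ─ q ∣ ∣ q ∣) (cong suc (∣p─q∣+∣q∣≡∣p∣ p q (Sub.drop-∷-⊆ q⊆p)))
∣p─q∣+∣q∣≡∣p∣ (true ∷ p)  (false ∷ q) q⊆p = cong suc (∣p─q∣+∣q∣≡∣p∣ p q (Sub.drop-∷-⊆ q⊆p))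
∣p─q∣+∣q∣≡∣p∣ (false ∷ p) (true ∷ q)  q⊆p = contradiction (q⊆p here) λ ()
∣p─q∣+∣q∣≡∣p∣ (false ∷ p) (false ∷ q) q⊆p = ∣p─q∣+∣q∣≡∣p∣ p q (Sub.drop-∷-⊆ q⊆p)

x∈p─q⇒x∉q : ∀ {n} (p q : Subset n) {x} → x ∈ˢ p ─ q → x ∉ˢ q
x∈p─q⇒x∉q (_ ∷ p)     (true ∷ q)  (there x∈) (there x∈q) = x∈p─q⇒x∉q p q x∈ x∈q
x∈p─q⇒x∉q (true ∷ p)  (false ∷ q) (there x∈) (there x∈q) = x∈p─q⇒x∉q p q x∈ x∈q
x∈p─q⇒x∉q (false ∷ p) (false ∷ q) (there x∈) (there x∈q) = x∈p─q⇒x∉q p q x∈ x∈q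

∣p∣≡0⇒x∉p : ∀ {n} (p : Subset n) → ∣ p ∣ ≡ 0 → ∀ {x} → x ∉ˢ p
∣p∣≡0⇒x∉p (false ∷ p) eq (there x∈) = ∣p∣≡0⇒x∉p p eq x∈

image : ∀ {m n} → (Fin m → Fin n) → Subset m → Subset n
image f []          = ⊥
image f (true ∷ p)  = ⁅ f zero ⁆ ∪ image (f ∘ suc) p
image f (false ∷ p) = image (f ∘ suc) p

∈-image⁺ : ∀ {m n} (f : Fin m → Fin n) p {x} → x ∈ˢ p → f x ∈ˢ image f p
∈-image⁺ f (true ∷ p)  here       = Sub.p⊆p∪q _ (Sub.x∈⁅x⁆ (f zero))
∈-image⁺ f (true ∷ p)  (there x∈) = Sub.q⊆p∪q _ _ (∈-image⁺ (f ∘ suc) p x∈)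
∈-image⁺ f (false ∷ p) (there x∈) = ∈-image⁺ (f ∘ suc) p x∈

∈-image⁻ : ∀ {m n} (f : Fin m → Fin n) p {y} → y ∈ˢ image f p → ∃[ x ] x ∈ˢ p × f x ≡ y
∈-image⁻ f []          y∈ = contradiction y∈ Sub.∉⊥
∈-image⁻ f (true ∷ p)  y∈ with Sub.x∈p∪q⁻ ⁅ f zero ⁆ _ y∈
... | inj₁ y∈⁅⁆ = zero , here , ≡.sym (Sub.x∈⁅y⁆⇒x≡y _ y∈⁅⁆)
... | inj₂ y∈im = let (x , x∈ , eq) = ∈-image⁻ (f ∘ suc) p y∈im in suc x , there x∈ , eq
∈-image⁻ f (false ∷ p) y∈ = let (x , x∈ , eq) = ∈-image⁻ (f ∘ suc) p y∈ in suc x , there x∈ , eq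

∣image∣≤ : ∀ {m n} (f : Fin m → Fin n) p → ∣ image f p ∣ ≤ ∣ p ∣
∣image∣≤ {n = n} f []  = ℕ.≤-reflexive (Sub.∣⊥∣≡0 n)
∣image∣≤ f (true ∷ p)  = ℕ.≤-trans (∣p∪q∣≤∣p∣+∣q∣ ⁅ f zero ⁆ _)
  (ℕ.+-mono-≤ (ℕ.≤-reflexive (Sub.∣⁅x⁆∣≡1 (f zero))) (∣image∣≤ (f ∘ suc) p))
∣image∣≤ f (false ∷ p) = ∣image∣≤ (f ∘ suc) p

∣∁⁅x⁆∣≡n∸1 : ∀ {n} (x : Fin n) → ∣ ∁ ⁅ x ⁆ ∣ ≡ n ℕ.∸ 1
∣∁⁅x⁆∣≡n∸1 {n} x = ≡.trans (Sub.∣∁p∣≡n∸∣p∣ ⁅ x ⁆) (cong (n ℕ.∸_) (Sub.∣⁅x⁆∣≡1 x))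

module _ {n} {p : Subset n} {x} (x∉p : x ∉ˢ p) where

  p⊆∁⁅x⁆ : p ⊆ˢ ∁ ⁅ x ⁆
  p⊆∁⁅x⁆ y∈p = Sub.x∉p⇒x∈∁p λ y∈⁅x⁆ → x∉p (subst (_∈ˢ p) (Sub.x∈⁅y⁆⇒x≡y x y∈⁅x⁆) y∈p)

  x∉p⇒∣p∣≤n∸1 : ∣ p ∣ ≤ n ℕ.∸ 1
  x∉p⇒∣p∣≤n∸1 = subst (∣ p ∣ ≤_) (∣∁⁅x⁆∣≡n∸1 x) (Sub.p⊆q⇒∣p∣≤∣q∣ p⊆∁⁅x⁆)

  -- If `y` were missing, `p` would lie strictly inside `∁ ⁅ x ⁆`, which has only `n ∸ 1` elements.
  x∉p∧∣p∣≡n∸1⇒y∈p : ∣ p ∣ ≡ n ℕ.∸ 1 → ∀ {y} → y ≢ x → y ∈ˢ p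
  x∉p∧∣p∣≡n∸1⇒y∈p eq {y} y≢x with y Sub.∈? p
  ... | yes y∈p = y∈p
  ... | no  y∉p = contradiction (≡.trans eq (≡.sym (∣∁⁅x⁆∣≡n∸1 x))) (ℕ.<⇒≢ (Sub.p⊂q⇒∣p∣<∣q∣
    (p⊆∁⁅x⁆ , y , Sub.x∉p⇒x∈∁p (Sub.x≢y⇒x∉⁅y⁆ y≢x) , y∉p)))

-- Numbering the classes of a decidable equivalence.

record Classes {N} (_∼_ : Fin N → Fin N → Set) : Set where
  field
    number     : ℕ
    class      : Fin N → Fin number
    rep        : Fin number → Fin N
    class-cong : ∀ {i j} → i ∼ j → class i ≡ class j
    class-rep  : ∀ c → class (rep c) ≡ c
    rep-class  : ∀ i → rep (class i) ∼ i

-- Induction on `N`: once the other elements are classified, `zero` joins the class of some related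
-- element, or opens a new class with itself as representative.
classes : ∀ {N} {_∼_ : Fin N → Fin N → Set} → IsEquivalence _∼_ → Decidable _∼_ → Classes _∼_
classes {zero} ∼-equiv _∼?_ = record
  { number = 0 ; class = λ () ; rep = λ () ; class-cong = λ {} ; class-rep = λ () ; rep-class = λ () }
classes {suc N} {_∼_} ∼-equiv _∼?_ with Fin.any? (λ j → zero ∼? suc j)
... | yes (j , 0∼j) = record
  { number = number
  ; class = λ { zero → class j ; (suc i) → class i }
  ; rep = suc ∘ rep
  ; class-cong = λ
      { {zero}  {zero}  e → ≡.refl
      ; {zero}  {suc l} e → class-cong (E.trans (E.sym 0∼j) e)
      ; {suc i} {zero}  e → class-cong (E.trans e 0∼j)
      ; {suc i} {suc l} e → class-cong e
      }
  ; class-rep = class-rep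
  ; rep-class = λ { zero → E.trans (rep-class j) (E.sym 0∼j) ; (suc i) → rep-class i }
  }
  where
  module E = IsEquivalence ∼-equiv
  open Classes (classes (On.isEquivalence suc ∼-equiv) (λ i j → suc i ∼? suc j))
... | no none = record
  { number = suc number
  ; class = λ { zero → zero ; (suc i) → suc (class i) }
  ; rep = λ { zero → zero ; (suc c) → suc (rep c) }
  ; class-cong = λ
      { {zero}  {zero}  e → ≡.refl
      ; {zero}  {suc l} e → contradiction (l , e) none
      ; {suc i} {zero}  e → contradiction (i , E.sym e) none
      ; {suc i} {suc l} e → cong suc (class-cong e)
      }
  ; class-rep = λ { zero → ≡.refl ; (suc c) → cong suc (class-rep c) }
  ; rep-class = λ { zero → E.refl ; (suc i) → rep-class i }
  }
  where
  module E = IsEquivalence ∼-equiv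
  open Classes (classes (On.isEquivalence suc ∼-equiv) (λ i j → suc i ∼? suc j))

-- Multiples and spans in a finite abelian group.

module FiniteGroupProperties (G : FiniteAbelianGroup) where
  open FiniteAbelianGroup G
  open GroupDec G using (Respects)
  open Inverse enumeration using (to; from-cong) renaming (strictlyInverseʳ to from∘to)
  open Algebra.Properties.AbelianGroup abelianGroup public
  open Algebra.Properties.CommutativeSemigroup commutativeSemigroup public
    using (interchange; xy∙z≈xz∙y)
  open Algebra.Properties.Monoid.Mult monoid public renaming (_×_ to _·_)
  open Relation.Binary.Reasoning.Setoid setoid

  to-injective : ∀ {x y} → to x ≡ to y → x ≈ y
  to-injective eq = trans (sym (from∘to _)) (trans (from-cong eq) (from∘to _))

  -- Among the `suc order` multiples of `x` from 0 to `order` two coincide, and their difference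
  -- vanishes.
  finiteOrder : ∀ x → ∃[ j ] suc j · x ≈ 0#
  finiteOrder x with Fin.pigeonhole (ℕ.n<1+n order) (λ i → to (toℕ i · x))
  ... | i , j , i<j , eq = l , identityʳ-unique (toℕ i · x) (suc l · x) (begin
    toℕ i · x + suc l · x      ≈⟨ ×-homo-+ x (toℕ i) (suc l) ⟨
    (toℕ i ℕ.+ suc l) · x      ≈⟨ ×-congˡ i+1+l≡j ⟩
    toℕ j · x                  ≈⟨ to-injective eq ⟨
    toℕ i · x                  ∎)
    where
    -- `suc l` is the difference of the two indices, positive because `i<j`.
    l = toℕ j ℕ.∸ suc (toℕ i)
    i+1+l≡j : toℕ i ℕ.+ suc l ≡ toℕ j
    i+1+l≡j = ≡.trans (ℕ.+-suc (toℕ i) l) (ℕ.m+[n∸m]≡n i<j)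

  -- No case for negation: in a finite group a submonoid is a subgroup.

  Span-induction : ∀ {A} (P : Pred Carrier 0ℓ) → Respects P → (∀ {x} → x ∈ A → P x) →
                   P 0# → (∀ {x y} → P x → P y → P (x + y)) → ∀ {x} → Span A x → P x
  Span-induction {A} P P-resp P-gen P-0 P-+ = go
    where
    multiple : ∀ j {x} → P x → P (j · x)
    multiple zero    p = P-0
    multiple (suc j) p = P-+ p (multiple j p)
    go : ∀ {x} → Span A x → P x
    go (gen x∈)     = P-gen x∈
    go zero         = P-0
    go (add p q)    = P-+ (go p) (go q)
    go (neg {x} p)  = let (j , eq) = finiteOrder x in P-resp (inverseʳ-unique x (j · x) eq) (multiple j (go p))
    go (resp x≈y p) = P-resp x≈y (go p)

  -- Natural multiples suffice, and are wanted: the multiplier will count the moves in `A` that the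
  -- robber has left.
  Span⁅k⁆⇒multiple : ∀ {k x} → Span ⁅ to k ⁆ x → ∃[ j ] j · k ≈ x
  Span⁅k⁆⇒multiple {k} = Span-induction (λ x → ∃[ j ] j · k ≈ x)
    (λ x≈y (j , eq) → j , trans eq x≈y)
    (λ x∈ → 1 , trans (×-homo-1 k) (sym (to-injective (Sub.x∈⁅y⁆⇒x≡y _ x∈))))
    (0 , refl)
    (λ (i , eq) (j , eq′) → i ℕ.+ j , trans (×-homo-+ k i j) (∙-cong eq eq′))

-- The quotient by a spanned subgroup.

module Quotient (G : FiniteAbelianGroup) (A : Subset (FiniteAbelianGroup.order G)) where
  open FiniteAbelianGroup G
  open FiniteGroupProperties G
  open GroupDec G using (module SpanDec)
  open Inverse enumeration using (to; from)
    renaming (strictlyInverseˡ to to∘from; strictlyInverseʳ to from∘to)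

  infix 4 _∼_ _∼?_
  _∼_ : Carrier → Carrier → Set
  x ∼ y = ∃[ z ] Span A z × x + z ≈ y

  ≈⇒∼ : ∀ {x y} → x ≈ y → x ∼ y
  ≈⇒∼ x≈y = 0# , zero , trans (identityʳ _) x≈y

  ∼-sym : ∀ {x y} → x ∼ y → y ∼ x
  ∼-sym {x} (z , p , eq) = - z , neg p , trans (∙-congʳ (sym eq)) (//-rightDividesʳ z x)

  ∼-trans : ∀ {x y z} → x ∼ y → y ∼ z → x ∼ z
  ∼-trans (u , p , eq) (v , q , eq′) = u + v , add p q , trans (sym (assoc _ _ _)) (trans (∙-congʳ eq) eq′)

  ∼-isEquivalence : IsEquivalence _∼_
  ∼-isEquivalence = record { refl = ≈⇒∼ refl ; sym = ∼-sym ; trans = ∼-trans }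

  ∼-+-cong : ∀ {x y u v} → x ∼ y → u ∼ v → x + u ∼ y + v
  ∼-+-cong (w , p , eq) (w′ , q , eq′) = w + w′ , add p q , trans (interchange _ _ _ _) (∙-cong eq eq′)

  ∼-neg-cong : ∀ {x y} → x ∼ y → - x ∼ - y
  ∼-neg-cong (z , p , eq) = - z , neg p , trans (⁻¹-∙-comm _ _) (⁻¹-cong eq)

  -- The only possible witness is `- x + y`, and membership in the span is decided by its
  -- computation as a least fixed point.
  _∼?_ : ∀ x y → Dec (x ∼ y)
  x ∼? y = map′
    (λ w∈ → - x + y , resp (from∘to _) (sound w∈) , \\-leftDividesˡ x y)
    (λ (z , p , eq) → complete (resp (trans (sym (\\-leftDividesʳ x z)) (∙-congˡ eq)) p))
    (to (- x + y) Sub.∈? C)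
    where open SpanDec A

  private
    -- Sealed so that the numbering of the classes does not unfold; only the fields of `Classes`
    -- matter below.
    abstract
      ∼-classes : Classes (λ i j → from i ∼ from j)
      ∼-classes = classes (On.isEquivalence from ∼-isEquivalence) (λ i j → from i ∼? from j)
    module C = Classes ∼-classes

  -- The carrier stays and only the equality becomes coarser. The projection is thus the identity,
  -- and positions in the two games have the same type.
  quotient : FiniteAbelianGroup
  quotient = record
    { abelianGroup = record
      { Carrier = Carrier ; _≈_ = _∼_ ; _∙_ = _+_ ; ε = 0# ; _⁻¹ = -_
      ; isAbelianGroup = record
        { isGroup = record
          { isMonoid = record
            { isSemigroup = record
              { isMagma = record { isEquivalence = ∼-isEquivalence ; ∙-cong = ∼-+-cong }
              ; assoc   = λ x y z → ≈⇒∼ (assoc x y z)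
              }
            ; identity = (λ x → ≈⇒∼ (identityˡ x)) , (λ x → ≈⇒∼ (identityʳ x))
            }
          ; inverse = (λ x → ≈⇒∼ (inverseˡ x)) , (λ x → ≈⇒∼ (inverseʳ x))
          ; ⁻¹-cong = ∼-neg-cong
          }
        ; comm = λ x y → ≈⇒∼ (comm x y)
        }
      }
    ; order = C.number
    ; enumeration = record
      { to        = class∘to
      ; from      = from ∘ C.rep
      ; to-cong   = class∘to-cong
      ; from-cong = λ { ≡.refl → ≈⇒∼ refl }
      ; inverse   = (λ {c} e → ≡.trans (class∘to-cong e)
                       (≡.trans (cong C.class (to∘from _)) (C.class-rep c)))
                  , (λ { {x} ≡.refl → ∼-trans (C.rep-class (to x)) (≈⇒∼ (from∘to x)) })
      }
    }
    where
    class∘to : Carrier → Fin C.number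
    class∘to = C.class ∘ to
    class∘to-cong : ∀ {x y} → x ∼ y → class∘to x ≡ class∘to y
    class∘to-cong {x} {y} e = C.class-cong (∼-trans (≈⇒∼ (from∘to x)) (∼-trans e (≈⇒∼ (sym (from∘to y)))))

  private module Q = FiniteAbelianGroup quotient

  -- Every class contains, with its representative r, also r + k.

  2*order≤ : ∀ {k} → Span A k → ¬ k ≈ 0# → 2 * Q.order ≤ order
  2*order≤ {k} k∈ k≉0 = Fin.injective⇒≤ {f = f} f-injective
    where
    rep : Fin Q.order → Carrier
    rep = Inverse.from Q.enumeration
    shift : Fin 2 → Carrier
    shift zero       = 0#
    shift (suc zero) = k
    shift∼0 : ∀ b → shift b ∼ 0#
    shift∼0 zero       = ≈⇒∼ refl
    shift∼0 (suc zero) = ∼-sym (k , k∈ , identityˡ k)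
    shift-injective : ∀ b b′ → shift b ≈ shift b′ → b ≡ b′
    shift-injective zero       zero       _  = ≡.refl
    shift-injective zero       (suc zero) eq = contradiction (sym eq) k≉0
    shift-injective (suc zero) zero       eq = contradiction eq k≉0
    shift-injective (suc zero) (suc zero) _  = ≡.refl
    f′ : Fin 2 × Fin Q.order → Fin order
    f′ (b , c) = to (rep c + shift b)
    f : Fin (2 * Q.order) → Fin order
    f i = f′ (remQuot Q.order i)
    rep∼ : ∀ b c → rep c + shift b ∼ rep c
    rep∼ b c = ∼-trans (∼-+-cong (≈⇒∼ refl) (shift∼0 b)) (≈⇒∼ (identityʳ _))
    f′-injective : ∀ p q → f′ p ≡ f′ q → p ≡ q
    f′-injective (b , c) (b′ , c′) eq with c≡c′
      where
      c≡c′ : c ≡ c′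
      c≡c′ = ≡.trans (≡.sym (Inverse.strictlyInverseˡ Q.enumeration c))
        (≡.trans (Inverse.to-cong Q.enumeration
          (∼-trans (∼-sym (rep∼ b c)) (∼-trans (≈⇒∼ (to-injective eq)) (rep∼ b′ c′))))
          (Inverse.strictlyInverseˡ Q.enumeration c′))
    ... | ≡.refl = cong (_, c) (shift-injective b b′ (∙-cancelˡ _ _ _ (to-injective eq)))
    f-injective : ∀ {i j} → f i ≡ f j → i ≡ j
    f-injective {i} {j} eq = ≡.trans (≡.sym (Fin.combine-remQuot {2} Q.order i))
      (≡.trans (cong (λ (b , c) → combine b c) (f′-injective (remQuot Q.order i) (remQuot Q.order j) eq))
        (Fin.combine-remQuot {2} Q.order j))

-- The images of `S` and `T` in the quotient.

module QuotientTriple (X : Triple) (A : Subset (Triple.order X)) where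
  open Triple X
  open Quotient G A
  open FiniteGroupProperties G using (ε⁻¹≈ε; ⁻¹-involutive)
  open FiniteGroupProperties quotient using () renaming (to-injective to class-injective)
  open GroupDec quotient using (∈-resp)
  open Inverse enumeration using (from)
    renaming (strictlyInverseˡ to to∘from; strictlyInverseʳ to from∘to)
  private
    module Q = FiniteAbelianGroup quotient
    π : Fin order → Fin Q.order
    π i = Inverse.to Q.enumeration (from i)
    0ᶜ : Fin Q.order
    0ᶜ = Inverse.to Q.enumeration 0#

  -- The zero class is removed because a triple must satisfy `0∉S`; moves inside the subgroup turn
  -- into staying in place.
  project : Subset order → Subset Q.order
  project B = image π B ─ ⁅ 0ᶜ ⁆

  0∉project : ∀ B → ¬ (0# Q.∈ project B)
  0∉project B 0∈ = x∈p─q⇒x∉q (image π B) ⁅ 0ᶜ ⁆ 0∈ (Sub.x∈⁅x⁆ 0ᶜ)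

  ∣project∣≤ : ∀ B → ∣ project B ∣ ≤ ∣ B ∣
  ∣project∣≤ B = ℕ.≤-trans (Sub.∣p─q∣≤∣p∣ (image π B) ⁅ 0ᶜ ⁆) (∣image∣≤ π B)

  ∈-project⁺ : ∀ {B x} → x ∈ B → ¬ (x ∼ 0#) → x Q.∈ project B
  ∈-project⁺ {B} {x} x∈ x≁0 = Sub.x∈p∧x≢y⇒x∈p-y
    (subst (_∈ˢ image π B) (Inverse.to-cong Q.enumeration (≈⇒∼ (from∘to x))) (∈-image⁺ π B x∈))
    (x≁0 ∘ class-injective)

  ∈-project⁻ : ∀ {B x} → x Q.∈ project B → ∃[ b ] b ∈ B × b ∼ x
  ∈-project⁻ {B} {x} x∈ with ∈-image⁻ π B (Sub.p─q⊆p (image π B) ⁅ 0ᶜ ⁆ x∈)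
  ... | i , i∈ , eq = from i , subst (_∈ˢ B) (≡.sym (to∘from i)) i∈ , class-injective eq

  project-mono : ∀ {B C} → B ⊆ˢ C → project B ⊆ˢ project C
  project-mono {B} {C} B⊆C {i} i∈ =
    let (x , x∈ , eq) = ∈-image⁻ π B (Sub.p─q⊆p (image π B) ⁅ 0ᶜ ⁆ i∈) in
    Sub.x∈p∧x≢y⇒x∈p-y (subst (_∈ˢ image π C) eq (∈-image⁺ π C (B⊆C x∈)))
      (λ i≡0 → x∈p─q⇒x∉q (image π B) ⁅ 0ᶜ ⁆ i∈ (subst (_∈ˢ ⁅ 0ᶜ ⁆) (≡.sym i≡0) (Sub.x∈⁅x⁆ 0ᶜ)))

  project-span : ∀ {B x} → Span B x → Q.Span (project B) x
  project-span {x = x} (gen x∈) with x ∼? 0#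
  ... | yes x∼0 = Q.resp (∼-sym x∼0) Q.zero
  ... | no  x≁0 = Q.gen (∈-project⁺ x∈ x≁0)
  project-span zero         = Q.zero
  project-span (add p q)    = Q.add (project-span p) (project-span q)
  project-span (neg p)      = Q.neg (project-span p)
  project-span (resp x≈y p) = Q.resp (≈⇒∼ x≈y) (project-span p)

  quotientTriple : Triple
  quotientTriple = record
    { G = quotient ; S = project S ; T = project T
    ; generates = project-span ∘ generates
    ; 0∉S = 0∉project S ; T⊆S = project-mono T⊆S }

  private
    symmetric-⊆ : Symmetric S → ∀ {x} → x Q.∈ project S → ∃[ a ] a Q.∈ project S × x ∼ - a
    symmetric-⊆ (f , _) {x} x∈ with ∈-project⁻ {S} {x} x∈
    ... | b , b∈ , b∼x with f b∈
    ...   | a , a∈ , b≈-a = a , ∈-project⁺ a∈ (λ a∼0 → 0∉project S (∈-resp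
              (∼-trans (∼-trans x∼-a (∼-neg-cong a∼0)) (≈⇒∼ (ε⁻¹≈ε))) x∈)) , x∼-a
      where x∼-a = ∼-trans (∼-sym b∼x) (≈⇒∼ b≈-a)

  -- An element and its negative lie in the zero class together, so discarding that class preserves
  -- symmetry.
  quotient-𝒢 : ∀ κ → 𝒢 κ X → 𝒢 κ quotientTriple
  quotient-𝒢 directed   _               = tt
  quotient-𝒢 undirected S-sym@(_ , g) = symmetric-⊆ S-sym , λ {x} (a , a∈ , x∼-a) →
    let (b , b∈ , b∼a) = ∈-project⁻ {S} {a} a∈
        -b∈ = g (b , b∈ , refl)
    in ∈-resp (∼-trans (∼-neg-cong b∼a) (∼-sym x∼-a)) (∈-project⁺ -b∈ λ -b∼0 →
         0∉project S (∈-resp (∼-trans (∼-sym b∼a) (∼-trans (≈⇒∼ (sym (⁻¹-involutive b)))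
           (∼-trans (∼-neg-cong -b∼0) (≈⇒∼ (ε⁻¹≈ε))))) a∈))

-- Elementary strategies.

-- The sum of the individual bounds serves for every index. It lets several cops complete their
-- walks in the same turn.
uniformBound : ∀ {m} (P : Fin m → ℕ → Set) → (∀ {i n} → P i n → P i (suc n)) →
               (∀ i → ∃[ n ] P i n) → ∃[ n ] ∀ i → P i n
uniformBound {zero}  P P-suc bound = 0 , λ ()
uniformBound {suc m} P P-suc bound with bound zero | uniformBound (P ∘ suc) P-suc (bound ∘ suc)
... | a , p | b , q = a ℕ.+ b , λ
  { zero    → subst (P zero) (ℕ.+-comm b a) (raise b p)
  ; (suc i) → raise a (q i) }
  where
  raise : ∀ {i n} k → P i n → P i (k ℕ.+ n)
  raise zero    p = p
  raise (suc k) p = P-suc (raise k p)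

∀-punchIn : ∀ {m} (i : Fin (suc m)) {P : Fin (suc m) → Set} → P i → (∀ j → P (punchIn i j)) → ∀ j → P j
∀-punchIn i {P} p q j with i Fin.≟ j
... | yes ≡.refl = p
... | no  i≢j    = subst P (Fin.punchIn-punchOut i≢j) (q (punchOut i≢j))

module Strategies (X : Triple) where
  open Triple X renaming (refl to ≈-refl)
  open Game X hiding (CopsWin; IsCopNumber)
  open FiniteGroupProperties G
  open GroupDec G using (_≈?_)
  open GameDec X using (step-resp)

  -- `Step` includes staying, so a walk in exactly `n` steps is as good as one in at most `n`.
  Reach : ℕ → Carrier → Carrier → Set
  Reach zero    x y = x ≈ y
  Reach (suc n) x y = ∃[ x′ ] Step S x x′ × Reach n x′ y

  Reach-resp : ∀ n {x x′ y y′} → x ≈ x′ → y ≈ y′ → Reach n x y → Reach n x′ y′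
  Reach-resp zero    p q e            = trans (sym p) (trans e q)
  Reach-resp (suc n) p q (z , st , w) = z , step-resp p ≈-refl st , Reach-resp n ≈-refl q w

  Reach-suc : ∀ n {x y} → Reach n x y → Reach (suc n) x y
  Reach-suc n w = _ , inj₁ ≈-refl , w

  Reach-++ : ∀ m n {x y z} → Reach m x y → Reach n y z → Reach (m ℕ.+ n) x z
  Reach-++ zero    n e            w = Reach-resp n (sym e) ≈-refl w
  Reach-++ (suc m) n (u , st , v) w = u , st , Reach-++ m n v w

  -- Arcs may be one-way, but `Span-induction` builds `- x + y` from elements of `S` by sums alone.
  reachable : ∀ x y → ∃[ n ] Reach n x y
  reachable x y = let (n , w) = Span-induction Reachable
                        (λ e (n , w) → n , λ x → Reach-resp n ≈-refl (∙-congˡ e) (w x))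
                        (λ x∈ → 1 , λ x → _ , inj₂ (_ , x∈ , ≈-refl) , ≈-refl)
                        (0 , λ x → sym (identityʳ x))
                        (λ (m , v) (n , w) → m ℕ.+ n , λ x →
                          Reach-resp (m ℕ.+ n) ≈-refl (assoc _ _ _) (Reach-++ m n (v x) (w _)))
                        (generates (- x + y))
                  in n , Reach-resp n ≈-refl (\\-leftDividesˡ x y) (w x)
    where
    Reachable : Carrier → Set
    -- One `n` for all starting points, so that the walk for a second summand can start where the
    -- first ends.
    Reachable z = ∃[ n ] ∀ x → Reach n x (x + z)

  -- Cop `i` of the larger team copies cop `f i`. The section `s` ensures that every original cop is
  -- copied, so captures persist.
  reindex-copTurn    : ∀ {m M x r} (f : Fin M → Fin m) (s : Fin m → Fin M) → (∀ i → f (s i) ≡ i) →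
                       CopTurn {m} x r → CopTurn {M} (x ∘ f) r
  reindex-robberTurn : ∀ {m M x r} (f : Fin M → Fin m) (s : Fin m → Fin M) → (∀ i → f (s i) ≡ i) →
                       RobberTurn {m} x r → RobberTurn {M} (x ∘ f) r
  reindex-copTurn {x = x} f s fs (caught (i , e)) = caught (s i , trans (reflexive (cong x (fs i))) e)
  reindex-copTurn f s fs (move y st w)    = move (y ∘ f) (st ∘ f) (reindex-robberTurn f s fs w)
  reindex-robberTurn {x = x} f s fs (caught (i , e)) = caught (s i , trans (reflexive (cong x (fs i))) e)
  reindex-robberTurn f s fs (move g) = move λ r′ st → reindex-copTurn f s fs (g r′ st)

  -- Along the branch where the robber always stays, the well-founded tree would have to end in a
  -- capture.
  noCops : ∀ {x r} → ¬ CopTurn {0} x r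
  noCops (caught ())
  noCops (move _ _ (caught ()))
  noCops (move _ _ (move f)) = noCops (f _ (inj₁ ≈-refl))

  CopsWin-suc : ∀ {m} → CopsWin X m → CopsWin X (suc m)
  CopsWin-suc {zero}  (x , win) = contradiction (win 0#) noCops
  CopsWin-suc {suc m} (x , win) = x ∘ f , λ r → reindex-copTurn f suc (λ _ → ≡.refl) (win r)
    where
    f : Fin (suc (suc m)) → Fin (suc m)
    f zero    = zero
    f (suc i) = i

  CopsWin-mono : ∀ {m n} → m ≤ n → CopsWin X m → CopsWin X n
  CopsWin-mono m≤n win = go (ℕ.≤⇒≤′ m≤n)
    where
    go : ∀ {n} → _ ℕ.≤′ n → CopsWin X n
    go ℕ.≤′-refl       = win
    go (ℕ.≤′-step m≤n) = CopsWin-suc (go m≤n)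

  -- The robber cannot leave the end of the walk, and each turn shortens the walk by one step.
  chase : (∀ {a} → ¬ (a ∈ T)) → ∀ n {x r} → Reach n (x zero) r → CopTurn {1} x r
  chase a∉T zero    e            = caught (zero , e)
  chase a∉T (suc n) (y , st , w) = move (λ _ → y) (λ { zero → st }) (move λ
    { r′ (inj₁ e)           → chase a∉T n (Reach-resp n ≈-refl (sym e) w)
    ; r′ (inj₂ (a , a∈ , _)) → contradiction a∈ a∉T })

  ∣T∣≡0⇒CopsWin : ∣ T ∣ ≡ 0 → CopsWin X 1
  ∣T∣≡0⇒CopsWin eq = (λ _ → 0#) , λ r → let (n , w) = reachable 0# r in chase (∣p∣≡0⇒x∉p T eq) n w

  -- Here `S` contains every nonzero element, so a cop at `0#` reaches any vertex in one move.
  ∣S∣≡n∸1⇒CopsWin : ∣ S ∣ ≡ order ℕ.∸ 1 → CopsWin X 1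
  ∣S∣≡n∸1⇒CopsWin eq = (λ _ → 0#) , win
    where
    win : ∀ r → CopTurn {1} (λ _ → 0#) r
    win r with r ≈? 0#
    ... | yes r≈0 = caught (zero , sym r≈0)
    ... | no  r≉0 = move (λ _ → r) (λ _ → inj₂ (r , x∉p∧∣p∣≡n∸1⇒y∈p 0∉S eq (r≉0 ∘ to-injective) , sym (identityˡ r)))
                         (caught (zero , ≈-refl))

restrict : (X : Triple) (U : Subset (Triple.order X)) → U ⊆ˢ Triple.T X → Triple
restrict X U U⊆T = record { Triple X ; T = U ; T⊆S = λ {i} i∈ → Triple.T⊆S X (U⊆T i∈) }

restrict-𝒢 : ∀ κ X U (U⊆T : U ⊆ˢ Triple.T X) → 𝒢 κ X → 𝒢 κ (restrict X U U⊆T)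
restrict-𝒢 directed   _ _ _ _  = tt
restrict-𝒢 undirected _ _ _ X∈ = X∈

-- A guard moving modulo `k`.

module Guarding (X : Triple) (k : Triple.Carrier X) (A : Subset (Triple.order X))
                (accounts : ∀ a → Triple._∈_ X a A → Triple.AccountsFor X k a) where
  open Triple X renaming (refl to ≈-refl)
  open Game X hiding (CopsWin; IsCopNumber)
  open FiniteGroupProperties G
  open GroupDec G using (_∈?_)
  open GameDec X using (step-resp)
  open Strategies X using (Reach; Reach-suc; reachable)
  open Inverse enumeration using (to)

  Y : Triple
  Y = restrict X (T ─ A) (Sub.p─q⊆p T A)

  Q : Triple
  Q = QuotientTriple.quotientTriple X ⁅ to k ⁆

  private
    module GY = Game Y
    module GQ = Game Q

  -- j is the number of moves in A after which a cop at x captures the robber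
  -- at r, if it plays by `follow`.

  Guards : ℕ → Carrier → Carrier → Set
  Guards j x r = r + j · k ≈ x

  -- A move in `A` uses up one copy of `k`. Any other move is copied, keeps the gap, and is handed
  -- back as a legal move in `Y`.
  follow : ∀ j {x r r′} → Guards (suc j) x r → Step T r r′ →
           (∃[ x′ ] Step S x x′ × Guards j x′ r′)
           ⊎ (Step (T ─ A) r r′ × ∃[ x′ ] Step S x x′ × Guards (suc j) x′ r′)
  follow j g (inj₁ e) = inj₂ (inj₁ e , _ , inj₁ ≈-refl , trans (∙-congʳ e) g)
  follow j {x} {r} {r′} g (inj₂ (a , a∈ , e)) with a ∈? A
  ... | no a∉A = inj₂ (inj₂ (a , Sub.x∈p∧x∉q⇒x∈p─q a∈ a∉A , e) , x + a , inj₂ (a , T⊆S a∈ , ≈-refl) ,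
                       trans (∙-congʳ e) (trans (xy∙z≈xz∙y r a _) (∙-congʳ g)))
  ... | yes a∈A with accounts a a∈A
  -- Since `a` is `k + b`, answering with `b` lets the robber absorb one of the `suc j` copies of
  -- `k`.
  ...   | b , b∈ , a-b≈k = inj₁ (x + b , step b∈ , (begin
    r′ + j · k                 ≈⟨ ∙-congʳ e ⟩
    r + a + j · k              ≈⟨ ∙-congʳ (∙-congˡ (//-rightDividesˡ b a)) ⟨
    r + ((a - b) + b) + j · k  ≈⟨ ∙-congʳ (∙-congˡ (∙-congʳ a-b≈k)) ⟩
    r + (k + b) + j · k        ≈⟨ ∙-congʳ (assoc r k b) ⟨
    r + k + b + j · k          ≈⟨ xy∙z≈xz∙y (r + k) b (j · k) ⟩
    r + k + j · k + b          ≈⟨ ∙-congʳ (assoc r k (j · k)) ⟩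
    r + suc j · k + b          ≈⟨ ∙-congʳ g ⟩
    x + b                      ∎))
    where
    open Relation.Binary.Reasoning.Setoid setoid
    step : (b ∈ S ⊎ b ≈ 0#) → Step S x (x + b)
    step (inj₁ b∈S) = inj₂ (b , b∈S , ≈-refl)
    step (inj₂ b≈0) = inj₁ (trans (∙-congˡ b≈0) (identityʳ x))

  module _ {M : ℕ} (win : CopsWin Y M) (i : Fin (suc M)) where

    private
      start : Fin M → Carrier
      start = proj₁ win

    others : (Fin (suc M) → Carrier) → Fin M → Carrier
    others z = z ∘ punchIn i

    -- The other cops may stand anywhere, so they can be left where the preceding phase ended.
    GuardWins : ℕ → Set
    GuardWins j = ∀ {z r} → Guards j (z i) r → RobberTurn {suc M} z r

    copMove : ∀ {z r} y x′ → (∀ l → Step S (others z l) (y l)) → Step S (z i) x′ →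
              RobberTurn (insertAt y i x′) r → CopTurn z r
    copMove {z} y x′ st st′ = move (insertAt y i x′) (∀-punchIn i
      (step-resp ≈-refl (reflexive (≡.sym (insertAt-lookup y i x′))) st′)
      (λ l → step-resp ≈-refl (reflexive (≡.sym (insertAt-punchIn y i x′ l))) (st l)))

    guards-insertAt : ∀ j {r} y x′ → Guards j x′ r → Guards j (insertAt y i x′ i) r
    guards-insertAt j y x′ g = trans g (reflexive (≡.sym (insertAt-lookup y i x′)))

    module _ (j : ℕ) (closer : GuardWins j) where

      -- Moves in `A` are settled by `closer` while the other cops stand still; `respond` has to
      -- treat only the moves outside `A`.
      robberMove : ∀ {z r} → Guards (suc j) (z i) r →
        (∀ {r′ x′} → Step (T ─ A) r r′ → Step S (z i) x′ → Guards (suc j) x′ r′ → CopTurn z r′) →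
        RobberTurn z r
      robberMove {z} g respond = move λ r′ st → [
        (λ (x′ , st′ , g′) → copMove (others z) x′ (λ _ → inj₁ ≈-refl) st′
          (closer (guards-insertAt j (others z) x′ g′))) ,
        (λ (st″ , x′ , st′ , g′) → respond st″ st′ g′) ]′ (follow j g st)

      -- The others follow the winning tree of `Y` while the guard keeps its gap. Their positions
      -- agree with `y` only pointwise, because `insertAt` and `punchIn` cancel only pointwise.
      play-copTurn    : ∀ {y z r x′} → GY.CopTurn y r → (∀ l → y l ≈ others z l) →
                        Step S (z i) x′ → Guards (suc j) x′ r → CopTurn z r
      play-robberTurn : ∀ {y z r} → GY.RobberTurn y r → (∀ l → y l ≈ others z l) →
                        Guards (suc j) (z i) r → RobberTurn z r
      play-copTurn (GY.caught (l , e)) y≈ st′ g = caught (punchIn i l , trans (sym (y≈ l)) e)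
      play-copTurn {x′ = x′} (GY.move y st w) y≈ st′ g = copMove y x′
        (λ l → step-resp (y≈ l) ≈-refl (st l)) st′
        (play-robberTurn w (λ l → reflexive (≡.sym (insertAt-punchIn y i x′ l))) (guards-insertAt (suc j) y x′ g))
      play-robberTurn (GY.caught (l , e)) y≈ g = caught (punchIn i l , trans (sym (y≈ l)) e)
      play-robberTurn (GY.move f) y≈ g = robberMove g λ st st′ g′ → play-copTurn (f _ st) y≈ st′ g′

      regroup : ∀ n {z r} → (∀ l → Reach n (others z l) (start l)) →
                Guards (suc j) (z i) r → RobberTurn z r
      -- The others are in place, so the robber's next position `r′` counts as his initial choice in
      -- the game on `Y`.
      regroup zero    w g = robberMove g λ {r′} st st′ g′ → play-copTurn (proj₂ win r′) (λ l → sym (w l)) st′ g′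
      regroup (suc n) w g = robberMove g λ {r′} {x′} st st′ g′ →
        let y = proj₁ ∘ w in
        copMove y x′ (λ l → proj₁ (proj₂ (w l))) st′ (regroup n
          (λ l → subst (λ u → Reach n u (start l)) (≡.sym (insertAt-punchIn y i x′ l)) (proj₂ (proj₂ (w l))))
          (guards-insertAt (suc j) y x′ g′))

    -- Each phase ends with a capture or with a move in `A`, which lowers `j`; at 0 the guard stands
    -- on the robber.
    guardWins : ∀ j → GuardWins j
    guardWins zero        g = caught (i , trans (sym g) (identityʳ _))
    guardWins (suc j) {z} g =
      let (n , w) = uniformBound (λ l n → Reach n (others z l) (start l)) (λ {l} {n} → Reach-suc n)
                      (λ l → reachable (others z l) (start l))
      in regroup j (guardWins j) n w g

  -- Lifting strategies from the quotient.

  open Quotient G ⁅ to k ⁆ using (_∼_; ≈⇒∼; ∼-sym; ∼-trans; ∼-+-cong; _∼?_)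
  open QuotientTriple X ⁅ to k ⁆ using (∈-project⁺; ∈-project⁻)

  -- Only the class of the cop matters, so any preimage `b` of the quotient move can be played.
  lift-step : ∀ {x x̃ y} → x ∼ x̃ → GQ.Step (Triple.S Q) x y → ∃[ ỹ ] Step S x̃ ỹ × y ∼ ỹ
  lift-step x∼ (inj₁ e) = _ , inj₁ ≈-refl , ∼-trans e x∼
  lift-step {x̃ = x̃} x∼ (inj₂ (a , a∈ , e)) =
    let (b , b∈ , b∼a) = ∈-project⁻ {S} {a} a∈
    in x̃ + b , inj₂ (b , b∈ , ≈-refl) , ∼-trans e (∼-+-cong x∼ (∼-sym b∼a))

  -- A move by an element of the zero class, which `project` has dropped, is seen as staying.
  project-step : ∀ {r r̃ r̃′} → r ∼ r̃ → Step T r̃ r̃′ → GQ.Step (Triple.T Q) r r̃′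
  project-step r∼ (inj₁ e) = inj₁ (∼-trans (≈⇒∼ e) (∼-sym r∼))
  project-step r∼ (inj₂ (a , a∈ , e)) with a ∼? 0#
  ... | yes a∼0 = inj₁ (∼-trans (≈⇒∼ e) (∼-trans (∼-+-cong (∼-sym r∼) a∼0) (≈⇒∼ (identityʳ _))))
  ... | no  a≁0 = inj₂ (a , ∈-project⁺ a∈ a≁0 , ∼-trans (≈⇒∼ e) (∼-+-cong (∼-sym r∼) (≈⇒∼ ≈-refl)))

  module _ {M : ℕ} (win : CopsWin Y M) where

    capturedModulo : ∀ {z : Fin (suc M) → Carrier} {r} i → z i ∼ r → RobberTurn z r
    capturedModulo i e with ∼-sym e
    ... | u , u∈ , eq with Span⁅k⁆⇒multiple u∈
    ...   | j , jk≈u = guardWins win i j (trans (∙-congˡ jk≈u) eq)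

    lift-copTurn    : ∀ {x z r r̃} → GQ.CopTurn {suc M} x r → (∀ l → x l ∼ z l) → r ∼ r̃ → CopTurn z r̃
    lift-robberTurn : ∀ {x z r r̃} → GQ.RobberTurn {suc M} x r → (∀ l → x l ∼ z l) → r ∼ r̃ → RobberTurn z r̃
    lift-copTurn {z = z} (GQ.caught (i , e)) x∼ r∼ =
      -- The guarding phase begins with a turn of the robber, so the cops pass.
      move z (λ _ → inj₁ ≈-refl) (capturedModulo i (∼-trans (∼-sym (x∼ i)) (∼-trans e r∼)))
    lift-copTurn (GQ.move y st w) x∼ r∼ =
      let lifted = λ l → lift-step (x∼ l) (st l) in
      move (proj₁ ∘ lifted) (proj₁ ∘ proj₂ ∘ lifted) (lift-robberTurn w (proj₂ ∘ proj₂ ∘ lifted) r∼)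
    lift-robberTurn (GQ.caught (i , e)) x∼ r∼ = capturedModulo i (∼-trans (∼-sym (x∼ i)) (∼-trans e r∼))
    lift-robberTurn (GQ.move f) x∼ r∼ = move λ r′ st →
      lift-copTurn (f r′ (project-step r∼ st)) x∼ (≈⇒∼ ≈-refl)

    -- Any of the `suc M` cops may be the one that captures modulo `k`; it becomes the guard and the
    -- remaining `M` play on `Y`.
    CopsWin-combine : CopsWin Q (suc M) → CopsWin X (suc M)
    CopsWin-combine (x , winQ) = x , λ r → lift-copTurn (winQ r) (λ _ → ≈⇒∼ ≈-refl) (≈⇒∼ ≈-refl)

-- The induction and the bound on the maximum.

InB? : ∀ p → Dec (InB p)
InB? (n , s , t) = (t ℕ.≟ 0) ⊎-dec (s ℕ.≟ n ℕ.∸ 1)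

InD∖B? : ∀ p → Dec (InD∖B p)
InD∖B? p@(n , s , t) = ((1 ℕ.≤? n) ×-dec (s ℕ.≤? n ℕ.∸ 1) ×-dec (t ℕ.≤? s)) ×-dec ¬? (InB? p)

card-InD : ∀ X → InD (Triple.card X)
card-InD X = ℕ.>-nonZero⁻¹ order {{Fin.nonZeroIndex (Inverse.to enumeration 0#)}} , x∉p⇒∣p∣≤n∸1 0∉S , Sub.p⊆q⇒∣p∣≤∣q∣ T⊆S
  where open Triple X

InB⇒CopsWin : ∀ X → InB (Triple.card X) → CopsWin X 1
InB⇒CopsWin X = [ ∣T∣≡0⇒CopsWin , ∣S∣≡n∸1⇒CopsWin ]′
  where open Strategies X

-- The cop number of `X` is among those maximised by `c`; the default value 1 is excluded by `X`
-- itself.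
CopsWin-c : ∀ κ d X → 𝒢 κ X → Triple.card X ≡ value d → ∃[ m ] CopsWin X m × m ≤ c κ d
CopsWin-c κ d X X∈ eq with GameDec.copNumber X | c-isMaxCopNumber κ d
... | m , isCop | inj₁ (_ , max)  = m , proj₁ isCop , max X X∈ eq m isCop
... | m , isCop | inj₂ (none , _) = contradiction (X , X∈ , eq) none

lemma2p8 : (κ : Kind) (g h : 𝒟∖ℬ → ℝ) →
    (∀ d → g d ≥ᴿ fromℕ 2) →
    (∀ d → fromℕ 0 <ᴿ h d) →
    (∀ d → (X : Triple) → 𝒢 κ X → Triple.card X ≡ value d →
    ∃[ k ] ¬ (Triple._≈_ X k (Triple.0# X)) × Triple.AccountsForAtLeast X (h d) k) →
    (∀ n s t (p : InD∖B (n , s , t)) n′ s′ t′ (p′ : InD∖B (n′ , s′ , t′)) →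
    2 * n′ ≤ n → s′ ≤ s → t′ ≤ t →
    g ((n , s , t) , [ p ]) ≥ᴿ fromℕ (c κ (inclusion ((n′ , s′ , t′) , [ p′ ])))
    ⊎ g ((n , s , t) , [ p ]) ≥ᴿ g ((n′ , s′ , t′) , [ p′ ])) →
    (∀ n s t (p : InD∖B (n , s , t)) t′ (p′ : InD∖B (n , s , t′)) →
    1 ≤ t′ → fromℕ t′ ≤ᴿ (fromℕ t -ᴿ h ((n , s , t) , [ p ])) →
    g ((n , s , t) , [ p ]) ≥ᴿ (g ((n , s , t′) , [ p′ ]) +ᴿ fromℕ 1)) →
    ∀ d → fromℕ (c κ (inclusion d)) ≤ᴿ g d
lemma2p8 κ g h g≥2 h>0 accounting quotients restrictions = maximum-bounded
  where

  module Step (X : Triple) (X∈ : 𝒢 κ X) (p : InD∖B (Triple.card X)) where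
    open Triple X using (order; S; T; _≈_; _∈_; 0#; AccountsFor; Carrier)

    d : 𝒟∖ℬ
    d = Triple.card X , [ p ]

    Bounded : ℕ → Set
    Bounded m = fromℕ m ≤ᴿ g d

    Induction : Set₁
    Induction = ∀ Z (q : InD∖B (Triple.card Z)) → 𝒢 κ Z → Triple.order Z ℕ.+ ∣ Triple.T Z ∣ ℕ.< order ℕ.+ ∣ T ∣ →
                ∃[ m ] CopsWin Z m × fromℕ m ≤ᴿ g (Triple.card Z , [ q ])

    module _ (ih : Induction) (k : Carrier) (k≉0 : ¬ k ≈ 0#) (A : Subset order) (A⊆T : A ⊆ˢ T)
             (accounts : ∀ a → a ∈ A → AccountsFor k a) (h≤∣A∣ : h d ≤ᴿ fromℕ ∣ A ∣) where
      open Guarding X k A accounts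
      open QuotientTriple X ⁅ Inverse.to (Triple.enumeration X) k ⁆ using (∣project∣≤; quotient-𝒢)

      halved : 2 * Triple.order Q ≤ order
      halved = Quotient.2*order≤ (Triple.G X) _ (FiniteAbelianGroup.gen {x = k} (Sub.x∈⁅x⁆ _)) k≉0

      smaller : Triple.order Q ℕ.< order
      smaller = ℕ.<-≤-trans (ℕ.m<m*n _ 2 {{ℕ.>-nonZero (proj₁ (card-InD Q))}} (s≤s (s≤s z≤n)))
                            (ℕ.≤-trans (ℕ.≤-reflexive (ℕ.*-comm (Triple.order Q) 2)) halved)

      boundQ : ∃[ m ] CopsWin Q m × Bounded m
      boundQ with InB? (Triple.card Q)
      -- `quotients` speaks only of cards outside `InB`; for those inside, one cop wins and `g d` is
      -- at least 2.
      ... | yes b = 1 , InB⇒CopsWin Q b , fromℕ-antitone (g d) (s≤s z≤n) (g≥2 d)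
      ... | no ¬b with quotients _ _ _ p _ _ _ (card-InD Q , ¬b) halved (∣project∣≤ S) (∣project∣≤ T)
      ...   | inj₁ c≤g = let (m , win , m≤c) = CopsWin-c κ (inclusion (Triple.card Q , [ card-InD Q , ¬b ])) Q
                                                (quotient-𝒢 κ X∈) ≡.refl
                         in m , win , fromℕ-antitone (g d) m≤c c≤g
      ...   | inj₂ g′≤g = let (m , win , m≤g′) = ih Q (card-InD Q , ¬b) (quotient-𝒢 κ X∈)
                                                    (ℕ.+-mono-<-≤ smaller (∣project∣≤ T))
                          in m , win , fromℕ-≤-trans (g (Triple.card Q , [ card-InD Q , ¬b ])) (g d) m≤g′ g′≤g

      boundY : ∃[ m ] CopsWin Y m × Bounded (suc m)
      boundY with ∣ T ─ A ∣ ℕ.≟ 0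
      -- `restrictions` requires a nonempty moveset. Here one cop wins on `Y`, and with the guard
      -- this makes 2, the lower bound of `g`.
      ... | yes ≡0 = 1 , InB⇒CopsWin Y (inj₁ ≡0) , g≥2 d
      ... | no  ≢0 = let (m , win , m≤g′) = ih Y q (restrict-𝒢 κ X _ (Sub.p─q⊆p T A) X∈) fewer
                     in m , win , fromℕ-≤-trans (g (Triple.card Y , [ q ]) +ᴿ fromℕ 1) (g d)
                          (fromℕ-suc-≤ (g (Triple.card Y , [ q ])) m≤g′)
                          (restrictions _ _ _ p _ q (ℕ.n≢0⇒n>0 ≢0) (fromℕ-∸-≤ (h d) ∣T─A∣+∣A∣≡∣T∣ h≤∣A∣))
        where
        q : InD∖B (Triple.card Y)
        -- Passing to `T ─ A` leaves the group and `S` unchanged, so `p` rules out the second case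
        -- of `InB`.
        q = card-InD Y , [ ≢0 , proj₂ p ∘ inj₂ ]′
        ∣T─A∣+∣A∣≡∣T∣ : ∣ T ─ A ∣ ℕ.+ ∣ A ∣ ≡ ∣ T ∣
        ∣T─A∣+∣A∣≡∣T∣ = ∣p─q∣+∣q∣≡∣p∣ T A A⊆T
        fewer : order ℕ.+ ∣ T ─ A ∣ ℕ.< order ℕ.+ ∣ T ∣
        fewer = ℕ.+-monoʳ-< order (subst (∣ T ─ A ∣ ℕ.<_) ∣T─A∣+∣A∣≡∣T∣
          (ℕ.m<m+n _ (positive-≤⇒0< (h d) (h>0 d) h≤∣A∣)))

      boundX : ∃[ m ] CopsWin X m × Bounded m
      boundX with boundQ | boundY
      -- Both games need the same team, of size the maximum of `mQ` and `suc mY`, each bounded by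
      -- `g d`.
      ... | mQ , winQ , mQ≤g | mY , winY , 1+mY≤g with ℕ.≤-total mQ (suc mY)
      ...   | inj₁ mQ≤1+mY = suc mY , CopsWin-combine winY (Strategies.CopsWin-mono Q mQ≤1+mY winQ) , 1+mY≤g
      boundX | suc m , winQ , mQ≤g | mY , winY , _ | inj₂ (s≤s mY≤m) =
        suc m , CopsWin-combine (Strategies.CopsWin-mono Y mY≤m winY) winQ , mQ≤g

  bounded : ∀ X → 𝒢 κ X → (p : InD∖B (Triple.card X)) → Acc ℕ._<_ (Triple.order X ℕ.+ ∣ Triple.T X ∣) →
            ∃[ m ] CopsWin X m × fromℕ m ≤ᴿ g (Triple.card X , [ p ])
  bounded X X∈ p (acc rec) with accounting (Triple.card X , [ p ]) X X∈ ≡.refl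
  ... | k , k≉0 , A , A⊆T , accounts , h≤∣A∣ = Step.boundX X X∈ p
    (λ Z q Z∈ Z< → bounded Z Z∈ q (rec Z<)) k k≉0 A A⊆T accounts h≤∣A∣

  maximum-bounded : ∀ d → fromℕ (c κ (inclusion d)) ≤ᴿ g d
  maximum-bounded d@(nst , [ p ]) with c-isMaxCopNumber κ (inclusion d)
  ... | inj₁ ((X , X∈ , ≡.refl , _ , min) , _) =
    -- The irrelevant proof `p` is recovered by decidability. The value of `c` is the cop number of
    -- `X`, so `min` bounds it by `m`.
    let (m , win , m≤g) = bounded X X∈ (recompute (InD∖B? nst) p) (<-wellFounded _)
    in fromℕ-antitone (g d) (min m win) m≤g
  -- With no triple of these cardinalities the value is 1, below the lower bound 2 of `g`.
  ... | inj₂ (_ , eq) = fromℕ-antitone (g d) (ℕ.≤-trans (ℕ.≤-reflexive eq) (s≤s z≤n)) (g≥2 d)
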